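{- Let $\rho: 2^{A^*} \to R$ be an alphabet compatible multiplicative rating map. Then the $\mathrm{FO}^2$-optimal universal $\rho$-imprint $\mathcal{I}_{\mathrm{FO}^2}[\rho]$ is the least (for inclusion) $\mathrm{FO}^2$-saturated subset of $R$ for $\rho$.
   Context: $A$ is a fixed finite alphabet; languages are subsets of $A^*$ and a class of languages is a set of languages over $A$. For $w \in A^*$, $\mathrm{alph}(w)$ is the set of letters occurring in $w$. **The class $\mathrm{FO}^2$.** A word is viewed as a (possibly empty) linearly ordered sequence of positions labeled over $A$; first-order sentences use unary predicates $P_a$ ($a\in A$) and the strict order $<$. $\mathrm{FO}^2$ sentences are those using at most two distinct variable names (which may be requantified). $\mathrm{FO}^2$ also denotes the class of languages over $A$ definable by such sentences. **Multiplicative rating maps.** Semirings have a commutative additive monoid $(R,+,0_R)$, a multiplicative monoid $(R,\cdot,1_R)$, multiplication distributes over addition, and $0_R$ is a zero for multiplication. A semiring is idempotent if $r+r=r$ for all $r$. It is ordered by $r\leq s$ iff $r+s=s$. A multiplicative rating map is a semiring morphism $\rho:(2^{A^*},\cup,\cdot)\to(R,+,\cdot)$ where $R$ is a finite idempotent semiring: $\rho(\emptyset)=0_R$, $\rho(K_1\cup K_2)=\rho(K_1)+\rho(K_2)$, $\rho(\{\varepsilon\})=1_R$, $\rho(K_1K_2)=\rho(K_1)\rho(K_2)$. Write $\rho(w)$ for $\rho(\{w\})$. It is alphabet compatible if there is a monoid morphism $r\mapsto\mathrm{alph}(r)$ from $(R,+)$ to $(2^{2^A},\cup)$ such that $\mathrm{alph}(\rho(K))=\{\mathrm{alph}(w)\mid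 w\in K\}$ for every $K\subseteq A^*$; such a morphism is fixed along with $\rho$. **Imprints.** For a finite set $\mathbf{K}$ of languages, $\mathcal{I}[\rho](\mathbf{K})=\{r\in R\mid \exists K\in\mathbf{K},\ r\leq\rho(K)\}$. A universal $\mathcal{C}$-cover is a finite set $\mathbf{K}$ of languages of $\mathcal{C}$ whose union is $A^*$. It is optimal for $\rho$ if $\mathcal{I}[\rho](\mathbf{K})\subseteq\mathcal{I}[\rho](\mathbf{K}')$ for every universal $\mathcal{C}$-cover $\mathbf{K}'$ (one always exists when $\mathcal{C}$ contains $\emptyset, A^*$ and is closed under union and intersection). $\mathcal{I}_{\mathcal{C}}[\rho]$ is $\mathcal{I}[\rho](\mathbf{K})$ for any optimal universal $\mathcal{C}$-cover $\mathbf{K}$ for $\rho$. **Saturation.** Let $\mathcal{I}_{triv}[\rho]=\{r\in R\mid \exists w\in A^*,\ r\leq\rho(w)\}$. A set $S\subseteq R$ is $\mathrm{FO}^2$-saturated for $\rho$ if it contains $\mathcal{I}_{triv}[\rho]$ and: (1) if $r\in S$ and $r'\leq r$ then $r'\in S$; (2) if $s,t\in S$ then $st\in S$; (3) for every $B\subseteq A$ and all multiplicative idempotents $e,f\in S$ with $\mathrm{alph}(e)=\mathrm{alph}(f)=\{B\}$, we have $e\cdot\rho(B^*)\cdot f\in S$. -}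

module Defs where

open import Level using (Level; 0ℓ; _⊔_) renaming (suc to lsuc)
open import Algebra.Bundles using (IdempotentSemiring)
open import Algebra.Bundles.Raw using (RawMonoid; RawSemiring)
open import Algebra.Morphism.Structures using (module MonoidMorphisms; module SemiringMorphisms)
open import Data.Fin.Base as Fin using (Fin)
import Data.Fin.Subset as Sub
open Sub using (Subset)
open import Data.List.Base using (List; []; map; length; lookup; _++_)
open import Data.List.Relation.Unary.All using (All)
open import Data.List.Relation.Unary.Any using (Any)
open import Data.Maybe.Base using (Maybe; just; nothing)
open import Data.Nat.Base using (ℕ)
open import Data.Product.Base using (Σ-syntax; ∃; ∃-syntax; ∃₂; _×_; _,_)
open import Data.Sum.Base using (_⊎_)
open import Data.Vec.Base as Vec using (Vec; replicate; _[_]≔_)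
open import Function.Bundles using (Inverse)
open import Relation.Binary.Bundles using (Setoid)
open import Relation.Binary.PropositionalEquality using (_≡_; setoid)
open import Relation.Nullary using (¬_)
open import Relation.Unary using (Pred; _∈_; _⊆_; _≐_; _∪_; ∅; ｛_｝)

private
  variable
    n k : ℕ
    c ℓ s : Level

------------------------------------------------------------------------
-- Words and languages over the alphabet Fin n

Word : ℕ → Set
Word n = List (Fin n)

Language : ℕ → Set₁
Language n = Pred (Word n) 0ℓ

Class : ℕ → Set₁
Class n = Pred (Language n) 0ℓ

alph : Word n → Subset n
alph w = Sub.⋃ (map Sub.⁅_⁆ w)

infixl 7 _·_

_·_ : Language n → Language n → Language n
(K · L) w = ∃₂ λ u v → u ∈ K × v ∈ L × w ≡ u ++ v

_* : Subset n → Language n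
B * = All (Sub._∈ B)

languageRawSemiring : ℕ → RawSemiring (lsuc 0ℓ) 0ℓ
languageRawSemiring n = record
  { Carrier = Language n
  ; _≈_     = _≐_
  ; _+_     = _∪_
  ; _*_     = _·_
  ; 0#      = ∅
  ; 1#      = ｛ [] ｝
  }

-- The monoid (2^(2^A) , ∪).
alphabetsRawMonoid : ℕ → RawMonoid (lsuc 0ℓ) 0ℓ
alphabetsRawMonoid n = record
  { Carrier = Pred (Subset n) 0ℓ
  ; _≈_     = _≐_
  ; _∙_     = _∪_
  ; ε       = ∅
  }

------------------------------------------------------------------------
-- First-order logic over words

-- Formulas over the alphabet Fin n whose variable names are taken from
-- Fin k; a name may be quantified any number of times.
data Formula (n k : ℕ) : Set where
  P        : Fin n → Fin k → Formula n k
  _≺_ _≋_  : Fin k → Fin k → Formula n k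
  neg      : Formula n k → Formula n k
  _and_    : Formula n k → Formula n k → Formula n k
  _or_     : Formula n k → Formula n k → Formula n k
  ex all   : Fin k → Formula n k → Formula n k

freeVars : Formula n k → Subset k
freeVars (P a x)   = Sub.⁅ x ⁆
freeVars (x ≺ y)   = Sub.⁅ x ⁆ Sub.∪ Sub.⁅ y ⁆
freeVars (x ≋ y)   = Sub.⁅ x ⁆ Sub.∪ Sub.⁅ y ⁆
freeVars (neg φ)   = freeVars φ
freeVars (φ and ψ) = freeVars φ Sub.∪ freeVars ψ
freeVars (φ or ψ)  = freeVars φ Sub.∪ freeVars ψ
freeVars (ex x φ)  = freeVars φ Sub.- x
freeVars (all x φ) = freeVars φ Sub.- x

Sentence : Formula n k → Set
Sentence φ = Sub.Empty (freeVars φ)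

Position : Word n → Set
Position w = Fin (length w)

-- Valuations are partial because the empty word has no position to assign.
-- An atom mentioning an unassigned variable is false; this never happens
-- when a sentence is evaluated from the nowhere defined valuation.
Valuation : Word n → ℕ → Set
Valuation w k = Vec (Maybe (Position w)) k

infix 4 _,_⊨_ _⊨_

_,_⊨_ : (w : Word n) → Valuation w k → Formula n k → Set
w , σ ⊨ P a x     = ∃[ i ] Vec.lookup σ x ≡ just i × lookup w i ≡ a
w , σ ⊨ (x ≺ y)   = ∃₂ λ i j → Vec.lookup σ x ≡ just i × Vec.lookup σ y ≡ just j × i Fin.< j
w , σ ⊨ (x ≋ y)   = ∃₂ λ i j → Vec.lookup σ x ≡ just i × Vec.lookup σ y ≡ just j × i ≡ j
w , σ ⊨ neg φ     = ¬ (w , σ ⊨ φ)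
w , σ ⊨ (φ and ψ) = (w , σ ⊨ φ) × (w , σ ⊨ ψ)
w , σ ⊨ (φ or ψ)  = (w , σ ⊨ φ) ⊎ (w , σ ⊨ ψ)
w , σ ⊨ ex x φ    = ∃ λ (i : Position w) → w , (σ [ x ]≔ just i) ⊨ φ
w , σ ⊨ all x φ   = ∀ (i : Position w) → w , (σ [ x ]≔ just i) ⊨ φ

_⊨_ : Word n → Formula n k → Set
w ⊨ φ = w , replicate _ nothing ⊨ φ

FO² : Class n
FO² {n} K = Σ[ φ ∈ Formula n 2 ] Sentence φ × K ≐ (_⊨ φ)

------------------------------------------------------------------------
-- Multiplicative rating maps

Finite : Setoid c ℓ → Set (c ⊔ ℓ)
Finite S = ∃[ m ] Inverse S (setoid (Fin m))

module _ (R : IdempotentSemiring c ℓ) where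

  open IdempotentSemiring R

  FiniteSemiring : Set (c ⊔ ℓ)
  FiniteSemiring = Finite (record { isEquivalence = isEquivalence })

  record RatingMap (n : ℕ) : Set (lsuc 0ℓ ⊔ c ⊔ ℓ) where
    open SemiringMorphisms (languageRawSemiring n) rawSemiring
    field
      ρ              : Language n → Carrier
      isHomomorphism : IsSemiringHomomorphism ρ

    ρʷ : Word n → Carrier
    ρʷ w = ρ ｛ w ｝

-- Languages are arbitrary predicates and a finite R has decidable equality,
-- so an alphabet compatible map ρ into a finite R makes every P : Set
-- decidable: compare the values of ρ on ｛ [] ｝ and on its subset cut out
-- by P.  The classical notion of subset is thus a consequence of the
-- hypotheses and excluded middle need not be assumed separately.
record AlphabetCompatible {R : IdempotentSemiring c ℓ} (ratingMap : RatingMap R n)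
       : Set (lsuc 0ℓ ⊔ c ⊔ ℓ) where
  open IdempotentSemiring R
  open RatingMap ratingMap
  open MonoidMorphisms +-rawMonoid (alphabetsRawMonoid n)
  field
    alphᴿ      : Carrier → Pred (Subset n) 0ℓ
    isMorphism : IsMonoidHomomorphism alphᴿ
    compatible : ∀ K → alphᴿ (ρ K) ≐ (λ B → ∃[ w ] w ∈ K × alph w ≡ B)

------------------------------------------------------------------------
-- Covers and imprints

-- A finite set of languages is given by a list enumerating it.
record UniversalCover (𝒞 : Class n) (𝐊 : List (Language n)) : Set (lsuc 0ℓ) where
  field
    inClass : All 𝒞 𝐊
    covers  : ∀ w → Any (w ∈_) 𝐊

module _ {R : IdempotentSemiring c ℓ} (ratingMap : RatingMap R n) where

  open IdempotentSemiring R
  open RatingMap ratingMap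

  infix 4 _≤_

  _≤_ : Carrier → Carrier → Set ℓ
  r ≤ t = r + t ≈ t

  imprint : List (Language n) → Pred Carrier (lsuc 0ℓ ⊔ ℓ)
  imprint 𝐊 r = Any (λ K → r ≤ ρ K) 𝐊

  trivialImprint : Pred Carrier ℓ
  trivialImprint r = ∃[ w ] r ≤ ρʷ w

  record OptimalCover (𝒞 : Class n) (𝐊 : List (Language n)) : Set (lsuc 0ℓ ⊔ c ⊔ ℓ) where
    field
      isCover : UniversalCover 𝒞 𝐊
      optimal : ∀ 𝐊′ → UniversalCover 𝒞 𝐊′ → imprint 𝐊 ⊆ imprint 𝐊′

  -- Optimal covers all have the same imprint (optimalImprint-unique below).
  -- The set is empty if there is no optimal cover, so proving that it
  -- contains some element includes proving that an optimal cover exists.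
  optimalImprint : Class n → Pred Carrier (lsuc 0ℓ ⊔ c ⊔ ℓ)
  optimalImprint 𝒞 r = ∃[ 𝐊 ] OptimalCover 𝒞 𝐊 × r ∈ imprint 𝐊

  optimalImprint-unique : ∀ {𝒞 𝐊} → OptimalCover 𝒞 𝐊 → optimalImprint 𝒞 ≐ imprint 𝐊
  optimalImprint-unique {𝐊 = 𝐊} o =
    (λ (_ , o′ , r∈) → OptimalCover.optimal o′ 𝐊 (OptimalCover.isCover o) r∈) ,
    (λ r∈ → 𝐊 , o , r∈)

------------------------------------------------------------------------
-- Saturation

module _ {R : IdempotentSemiring c ℓ} {ratingMap : RatingMap R n}
         (compat : AlphabetCompatible ratingMap) where

  open IdempotentSemiring R renaming (_*_ to _⊙_)
  open RatingMap ratingMap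
  open AlphabetCompatible compat using (alphᴿ)

  record FO²-Saturated (S : Pred Carrier s) : Set (c ⊔ ℓ ⊔ s) where
    field
      trivial   : trivialImprint ratingMap ⊆ S
      downward  : ∀ {r r′} → r ∈ S → _≤_ ratingMap r′ r → r′ ∈ S
      multiply  : ∀ {t u} → t ∈ S → u ∈ S → t ⊙ u ∈ S
      operation : ∀ (B : Subset n) {e f} → e ∈ S → f ∈ S →
                  e ⊙ e ≈ e → f ⊙ f ≈ f →
                  alphᴿ e ≐ ｛ B ｝ → alphᴿ f ≐ ｛ B ｝ →
                  (e ⊙ ρ (B *)) ⊙ f ∈ S

module Submission where

-- Write w ≈[ k ] w′ if Duplicator wins the k-round two-pebble game on w and w′. Every FO²
-- language is a union of classes for some k, and conversely the k-classes are separated by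
-- finitely many FO² sentences.
--
-- Soundness: the elements below the value of some k-class form a saturated set, since
-- u^k x v^k ≈[ k ] u^k v^k whenever alph u = alph v = B and x ∈ B*.
--
-- Completeness: let S be saturated. By induction on |B|, then on s, then on t, some k satisfies
-- s ρ([w]) t ∈ S for the k-class [w] of every w ∈ B*. If there is a letter b ∈ B such that, for
-- all u ∈ (B ∖ b)*, one cannot return from s ρ([u]) ρ(b) to s by a right multiplication, cut w
-- at its first b and continue from this smaller element; dually for t and the last b. Otherwise
-- multiplying the return paths over all b ∈ B gives idempotents e, f ∈ S of alphabet B with
-- s e = s and f t = t, so that s ρ(B*) t = s (e ρ(B*) f) t ∈ S. For B = A and s = t = 1, this
-- provides a cover whose imprint is contained in S.

open import Defs
open import Level using (Level; 0ℓ)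
open import Algebra.Bundles using (IdempotentSemiring)
open import Algebra.Morphism.Structures using (module MonoidMorphisms; module SemiringMorphisms)
import Algebra.Properties.Semiring.Exp as Exp
open import Data.Empty using (⊥-elim)
open import Data.Fin.Base as Fin using (Fin; zero; suc; toℕ)
open import Data.Fin.Induction using (spo-wellFounded)
open import Data.Fin.Properties using (_≟_; <-cmp; pigeonhole)
open import Data.Fin.Subset using (Subset)
import Data.Fin.Subset as Sub
import Data.Fin.Subset.Properties as Sub
open import Data.List.Base using (List; []; _∷_; [_]; _++_; length; lookup; map; reverse; allFin)
import Data.List.Membership.Propositional as List
open import Data.List.Membership.Propositional.Properties
  using (∈-map⁺; ∈-map⁻; ∈-++⁺ˡ; ∈-++⁺ʳ; ∈-++⁻; ∈-allFin)
open import Data.List.Properties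
  using (∷-injective; ++-assoc; ++-identityʳ; length-++; reverse-++; unfold-reverse; reverse-involutive)
open import Data.List.Relation.Unary.All as All using (All; []; _∷_)
import Data.List.Relation.Unary.All.Properties as All
open import Data.List.Relation.Unary.Any using (Any; here; there)
import Data.List.Relation.Unary.Any.Properties as Any
open import Data.Maybe.Base using (Maybe; just; nothing)
open import Data.Maybe.Properties using (just-injective)
open import Data.Nat.Base as ℕ using (ℕ; zero; suc; z≤n; s≤s)
open import Data.Nat.Induction using (<-wellFounded)
open import Data.Nat.Properties as ℕ using (n≤1+n; ≤-refl; ≤-trans; m≤m⊔n; m≤n⊔m; m<m+n; <-irrefl)
open import Data.Nat.Tactic.RingSolver using (solve-∀)
open import Data.Product.Base using (∃₂; ∃-syntax; Σ-syntax; _×_; _,_; proj₁; proj₂; map₂; swap)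
open import Data.Sum.Base as Sum using (_⊎_; inj₁; inj₂; [_,_]′)
open import Data.Unit.Base using (⊤; tt)
open import Data.Vec.Base as Vec using ([]; _∷_; there; _[_]≔_)
open import Data.Vec.Properties using (lookup∘update)
open import Function.Base using (_∘_; id)
open import Function.Bundles using (Inverse)
open import Induction.WellFounded using (Acc; acc; WellFounded)
open import Relation.Binary.Definitions using (tri<; tri≈; tri>)
open import Relation.Binary.PropositionalEquality as ≡
  using (_≡_; _≢_; refl; sym; trans; cong; cong₂; subst; subst₂)
import Relation.Binary.Reasoning.Setoid as SetoidReasoning
open import Relation.Nullary using (Dec; yes; no; ¬_)
open import Relation.Nullary.Decidable using (map′; decidable-stable)
open import Relation.Unary using (Pred; _∈_; _⊆_; _≐_; ｛_｝)

-- Progress cannot always come from the alphabet: behind the first `b` the rest of the word may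
-- still use all of B, so the contexts s and t are carried along and one of them has to drop
-- strictly. The induction on the alphabet serves two purposes. It settles the words without `b`,
-- and, with trivial contexts, it puts the value of the class of the prefix u into S; without this
-- neither the new context nor a return path could be used.
--
-- Saturation only applies to idempotents whose alphabet is exactly known, which is why return paths
-- are confined to products of values of languages with a single alphabet.
--
-- Completeness is applied to the least saturated set alone. It yields a cover whose imprint lies in
-- that set, while soundness puts that set into the imprint of every cover. This cover is therefore
-- optimal, and the existence of an optimal cover needs no separate argument.

private
  variable
    n k j l : ℕ

-- Pointed words

infix 6 _◁_▷_

-- Positions are factorisations rather than indices, so that prefixing and suffixing a word act on
-- them without arithmetic; `at` translates from indices once formulas come in.
record Pointed (n : ℕ) : Set where
  constructor _◁_▷_
  field
    left   : Word n
    letter : Fin n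
    right  : Word n

open Pointed

private
  variable
    p q r          : Pointed n
    u v w w′ x y : Word n

word : Pointed n → Word n
word (l ◁ a ▷ r) = l ++ a ∷ r

infix 4 _⊰_

-- The witness `m` is the factor strictly between the two positions. No common word is mentioned,
-- yet the two equations force one (`⊰⇒word≡`).
_⊰_ : Pointed n → Pointed n → Set
p ⊰ q = ∃[ m ] left q ≡ left p ++ letter p ∷ m × right p ≡ m ++ letter q ∷ right q

infixr 7 _◃_
infixl 8 _▹_

_◃_ : Word n → Pointed n → Pointed n
u ◃ (l ◁ a ▷ r) = (u ++ l) ◁ a ▷ r

_▹_ : Pointed n → Word n → Pointed n
(l ◁ a ▷ r) ▹ v = l ◁ a ▷ (r ++ v)

-- Levi's lemma with a pivot: it decides on which side of a concatenation a move falls.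
split-++ : ∀ (x y l : Word n) {c r} → x ++ y ≡ l ++ c ∷ r →
           (∃[ m ] x ≡ l ++ c ∷ m × r ≡ m ++ y) ⊎ (∃[ m ] l ≡ x ++ m × y ≡ m ++ c ∷ r)
split-++ []      y l       eq   = inj₂ (l , refl , eq)
split-++ (_ ∷ x) y []      refl = inj₁ (x , refl , refl)
split-++ (_ ∷ x) y (_ ∷ l) eq with ∷-injective eq
... | refl , eq′ with split-++ x y l eq′
...   | inj₁ (m , refl , eq″) = inj₁ (m , refl , eq″)
...   | inj₂ (m , refl , eq″) = inj₂ (m , refl , eq″)

⊰⇒word≡ : ∀ (p q : Pointed n) → p ⊰ q → word p ≡ word q
⊰⇒word≡ (l ◁ a ▷ _) (_ ◁ c ▷ r) (m , refl , refl) = sym (++-assoc l (a ∷ m) (c ∷ r))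

word-▹ : ∀ (p : Pointed n) v → word (p ▹ v) ≡ word p ++ v
word-▹ (l ◁ a ▷ r) v = sym (++-assoc l (a ∷ r) v)

word-◃ : ∀ u (p : Pointed n) → word (u ◃ p) ≡ u ++ word p
word-◃ u (l ◁ a ▷ r) = ++-assoc u l (a ∷ r)

▹-▹ : ∀ (p : Pointed n) u v → p ▹ u ▹ v ≡ p ▹ (u ++ v)
▹-▹ (l ◁ a ▷ r) u v = cong (l ◁ a ▷_) (++-assoc r u v)

◃-◃ : ∀ u v (p : Pointed n) → u ◃ v ◃ p ≡ (u ++ v) ◃ p
◃-◃ u v (l ◁ a ▷ r) = cong (_◁ a ▷ r) (sym (++-assoc u v l))

▹-mono : ∀ (p q : Pointed n) v → p ⊰ q → (p ▹ v) ⊰ (q ▹ v)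
▹-mono p q v (m , refl , refl) = m , refl , ++-assoc m (letter q ∷ right q) v

◃-mono : ∀ u (p q : Pointed n) → p ⊰ q → (u ◃ p) ⊰ (u ◃ q)
◃-mono u p q (m , refl , refl) = m , sym (++-assoc u (left p) (letter p ∷ m)) , refl

▹⊰◃ : ∀ (p q : Pointed n) → (p ▹ word q) ⊰ (word p ◃ q)
▹⊰◃ (l ◁ a ▷ r) (l′ ◁ c ▷ r′) =
  r ++ l′ , ++-assoc l (a ∷ r) l′ , sym (++-assoc r l′ (c ∷ r′))

⊰▹⁻ : ∀ (p q : Pointed n) v → q ⊰ (p ▹ v) → ∃[ q₀ ] q₀ ⊰ p × q ≡ q₀ ▹ v
⊰▹⁻ (_ ◁ a ▷ r) (l ◁ c ▷ _) v (m , refl , refl) =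
  l ◁ c ▷ (m ++ a ∷ r) , (m , refl , refl) , cong (l ◁ c ▷_) (sym (++-assoc m (a ∷ r) v))

◃⊰⁻ : ∀ u (p q : Pointed n) → (u ◃ p) ⊰ q → ∃[ q₀ ] p ⊰ q₀ × q ≡ u ◃ q₀
◃⊰⁻ u (l ◁ a ▷ _) (_ ◁ c ▷ r) (m , refl , refl) =
  (l ++ a ∷ m) ◁ c ▷ r , (m , refl , refl) , cong (_◁ c ▷ r) (++-assoc u l (a ∷ m))

word⁻ : ∀ x y (q : Pointed n) → x ++ y ≡ word q →
        (∃[ q₀ ] x ≡ word q₀ × q ≡ q₀ ▹ y) ⊎ (∃[ q₀ ] y ≡ word q₀ × q ≡ x ◃ q₀)
word⁻ x y (l ◁ c ▷ r) eq with split-++ x y l eq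
... | inj₁ (m , refl , refl) = inj₁ (l ◁ c ▷ m , refl , refl)
... | inj₂ (m , refl , refl) = inj₂ (m ◁ c ▷ r , refl , refl)

▹⊰⁻ : ∀ (p q : Pointed n) v → (p ▹ v) ⊰ q →
      (∃[ q₀ ] p ⊰ q₀ × q ≡ q₀ ▹ v) ⊎ (∃[ q₀ ] v ≡ word q₀ × q ≡ word p ◃ q₀)
▹⊰⁻ (l ◁ a ▷ r) (_ ◁ c ▷ r′) v (m , refl , eq) with split-++ r v m eq
... | inj₁ (m′ , refl , refl) = inj₁ ((l ++ a ∷ m) ◁ c ▷ m′ , (m , refl , refl) , refl)
... | inj₂ (m′ , refl , refl) =
  inj₂ (m′ ◁ c ▷ r′ , refl , cong (_◁ c ▷ r′) (sym (++-assoc l (a ∷ r) m′)))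

⊰◃⁻ : ∀ u (p q : Pointed n) → q ⊰ (u ◃ p) →
      (∃[ q₀ ] q₀ ⊰ p × q ≡ u ◃ q₀) ⊎ (∃[ q₀ ] u ≡ word q₀ × q ≡ q₀ ▹ word p)
⊰◃⁻ u (l ◁ a ▷ r) (l′ ◁ c ▷ _) (m , eq , refl) with split-++ u l l′ eq
... | inj₁ (m′ , refl , refl) =
  inj₂ (l′ ◁ c ▷ m′ , refl , cong (l′ ◁ c ▷_) (++-assoc m′ l (a ∷ r)))
... | inj₂ (m′ , refl , refl) = inj₁ (m′ ◁ c ▷ (m ++ a ∷ r) , (m , refl , refl) , refl)

reverseᵖ : Pointed n → Pointed n
reverseᵖ (l ◁ a ▷ r) = reverse r ◁ a ▷ reverse l

reverse-pivot : ∀ l (a : Fin n) r → reverse (l ++ a ∷ r) ≡ reverse r ++ a ∷ reverse l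
reverse-pivot l a r = trans (reverse-++ l (a ∷ r))
  (trans (cong (_++ reverse l) (unfold-reverse a r)) (++-assoc (reverse r) (a ∷ []) (reverse l)))

reverseᵖ-⊰ : ∀ (p q : Pointed n) → p ⊰ q → reverseᵖ q ⊰ reverseᵖ p
reverseᵖ-⊰ (l ◁ a ▷ _) (_ ◁ c ▷ r) (m , refl , refl) =
  reverse m , reverse-pivot m c r , reverse-pivot l a m

reverseᵖ-involutive : ∀ (p : Pointed n) → reverseᵖ (reverseᵖ p) ≡ p
reverseᵖ-involutive (l ◁ a ▷ r)
  rewrite reverse-involutive l | reverse-involutive r = refl

-- The two-pebble game

-- Only one pebble is recorded: the other one is moved next, and constrains this move only
-- through its position relative to the first one.

Forth : {A : Set} → (A → A → Set) → (A → Set) → (A → Set) → Set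
Forth Z X Y = ∀ p → X p → ∃[ q ] Y q × Z p q

Match : {A : Set} → (A → A → Set) → (A → Set) → (A → Set) → Set
Match Z X Y = Forth Z X Y × Forth Z Y X

infix 4 _∼[_]_ _≈[_]_

-- The two matches are the moves before and after the pebble. A move onto the pebble itself is
-- answered by the opposite pebble and can be left out.
data _∼[_]_ {n} : Pointed n → ℕ → Pointed n → Set where
  base : letter p ≡ letter q → p ∼[ 0 ] q
  step : letter p ≡ letter q →
         Match _∼[ k ]_ (_⊰ p) (_⊰ q) → Match _∼[ k ]_ (p ⊰_) (q ⊰_) → p ∼[ suc k ] q

data _≈[_]_ {n} : Word n → ℕ → Word n → Set where
  base : w ≈[ 0 ] v
  step : Match _∼[ k ]_ (λ p → w ≡ word p) (λ p → v ≡ word p) → w ≈[ suc k ] v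

∼⇒letter≡ : p ∼[ k ] q → letter p ≡ letter q
∼⇒letter≡ (base eq)     = eq
∼⇒letter≡ (step eq _ _) = eq

module _ {A : Set} {Z : A → A → Set} where

  Forth-refl : (∀ p → Z p p) → ∀ {X : A → Set} → Forth Z X X
  Forth-refl rfl p h = p , h , rfl p

  Forth-trans : (∀ {p q r} → Z p q → Z q r → Z p r) →
                ∀ {X Y V : A → Set} → Forth Z X Y → Forth Z Y V → Forth Z X V
  Forth-trans tr f g p h =
    let q , h′ , z = f p h ; r , h″ , z′ = g q h′ in r , h″ , tr z z′

  Forth-mono : ∀ {Z′ : A → A → Set} → (∀ {p q} → Z p q → Z′ p q) →
               ∀ {X Y : A → Set} → Forth Z X Y → Forth Z′ X Y
  Forth-mono f g p h = let q , h′ , z = g p h in q , h′ , f z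

∼-refl : ∀ k (p : Pointed n) → p ∼[ k ] p
∼-refl zero    p = base refl
∼-refl (suc k) p = step refl (F , F) (F , F)
  where
  F : ∀ {X} → Forth _∼[ k ]_ X X
  F = Forth-refl (∼-refl k)

∼-sym : p ∼[ k ] q → q ∼[ k ] p
∼-sym (base eq)     = base (sym eq)
∼-sym (step eq f g) = step (sym eq) (swap f) (swap g)

∼-trans : p ∼[ k ] q → q ∼[ k ] r → p ∼[ k ] r
∼-trans (base eq)     (base eq′)      = base (trans eq eq′)
∼-trans (step eq (a , b) (c , d)) (step eq′ (a′ , b′) (c′ , d′)) =
  step (trans eq eq′) (Forth-trans ∼-trans a a′ , Forth-trans ∼-trans b′ b)
                       (Forth-trans ∼-trans c c′ , Forth-trans ∼-trans d′ d)

≈-refl : ∀ k (w : Word n) → w ≈[ k ] w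
≈-refl zero    w = base
≈-refl (suc k) w = step (Forth-refl (∼-refl k) , Forth-refl (∼-refl k))

≈-sym : w ≈[ k ] v → v ≈[ k ] w
≈-sym base     = base
≈-sym (step f) = step (swap f)

≈-trans : u ≈[ k ] v → v ≈[ k ] w → u ≈[ k ] w
≈-trans base           base           = base
≈-trans (step (a , b)) (step (c , d)) = step (Forth-trans ∼-trans a c , Forth-trans ∼-trans d b)

∼-mono : j ℕ.≤ k → p ∼[ k ] q → p ∼[ j ] q
∼-mono z≤n       e                           = base (∼⇒letter≡ e)
∼-mono (s≤s j≤k) (step eq (a , b) (c , d)) = step eq (F a , F b) (F c , F d)
  where
  F : ∀ {X Y} → Forth _∼[ _ ]_ X Y → Forth _∼[ _ ]_ X Y
  F = Forth-mono (∼-mono j≤k)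

≈-mono : j ℕ.≤ k → w ≈[ k ] v → w ≈[ j ] v
≈-mono z≤n       _              = base
≈-mono (s≤s j≤k) (step (a , b)) = step (Forth-mono (∼-mono j≤k) a , Forth-mono (∼-mono j≤k) b)

-- Spoiler's first move falls before, on or after the forgotten pebble; in the middle case `q`
-- itself is the answer, at the cost of one round.
∼⇒≈ : ∀ k (p q : Pointed n) → p ∼[ k ] q → word p ≈[ k ] word q
∼⇒≈ zero    p q e = base
∼⇒≈ (suc k) p q e = step (F p q e , F q p (∼-sym e))
  where
  F : ∀ p q → p ∼[ suc k ] q → Forth _∼[ k ]_ (λ r → word p ≡ word r) (λ r → word q ≡ word r)
  F p@(l ◁ a ▷ t) q e@(step _ (f , _) (g , _)) r@(l′ ◁ _ ▷ _) eq with split-++ l (a ∷ t) l′ eq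
  ... | inj₁ (m , h , h′) = let s , b , z = f r (m , h , h′) in s , sym (⊰⇒word≡ s q b) , z
  ... | inj₂ ([] , refl , refl) rewrite ++-identityʳ l = q , refl , ∼-mono (n≤1+n k) e
  ... | inj₂ (_ ∷ m , h , refl) = let s , b , z = g r (m , h , refl) in s , ⊰⇒word≡ q s b , z

-- The two lemmas are mutual because a move out of the factor that holds the pebble hands over to
-- the other one. The factor left behind is from then on compared as a word without pebble, by
-- `∼⇒≈`.
▹-cong : ∀ k (p q : Pointed n) → p ∼[ k ] q → v ≈[ k ] w → (p ▹ v) ∼[ k ] (q ▹ w)
◃-cong : ∀ k (p q : Pointed n) → v ≈[ k ] w → p ∼[ k ] q → (v ◃ p) ∼[ k ] (w ◃ q)

▹-cong zero    p q (base eq) _ = base eq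
▹-cong (suc k) p q e g =
  step (∼⇒letter≡ e) (before p q e g , before q p (∼-sym e) (≈-sym g))
                     (after p q e g , after q p (∼-sym e) (≈-sym g))
  where
  before : ∀ p q {v w} → p ∼[ suc k ] q → v ≈[ suc k ] w → Forth _∼[ k ]_ (_⊰ p ▹ v) (_⊰ q ▹ w)
  before p q {v} {w} (step _ (f , _) _) g r r⊰ with ⊰▹⁻ p r v r⊰
  ... | r₀ , r₀⊰p , refl = let s , s⊰q , z = f r₀ r₀⊰p in
    s ▹ w , ▹-mono s q w s⊰q , ▹-cong k r₀ s z (≈-mono (n≤1+n k) g)
  after : ∀ p q {v w} → p ∼[ suc k ] q → v ≈[ suc k ] w → Forth _∼[ k ]_ (p ▹ v ⊰_) (q ▹ w ⊰_)
  after p q {v} {w} e@(step _ _ (f , _)) g@(step (h , _)) r ⊰r with ▹⊰⁻ p r v ⊰r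
  ... | inj₁ (r₀ , p⊰r₀ , refl) = let s , q⊰s , z = f r₀ p⊰r₀ in
    s ▹ w , ▹-mono q s w q⊰s , ▹-cong k r₀ s z (≈-mono (n≤1+n k) g)
  ... | inj₂ (r₀ , v≡ , refl) with h r₀ v≡
  ...   | s , refl , z = word q ◃ s , ▹⊰◃ q s , ◃-cong k r₀ s (∼⇒≈ k p q (∼-mono (n≤1+n k) e)) z

◃-cong zero    p q _ (base eq) = base eq
◃-cong (suc k) p q g e =
  step (∼⇒letter≡ e) (before p q e g , before q p (∼-sym e) (≈-sym g))
                     (after p q e g , after q p (∼-sym e) (≈-sym g))
  where
  after : ∀ p q {v w} → p ∼[ suc k ] q → v ≈[ suc k ] w → Forth _∼[ k ]_ (v ◃ p ⊰_) (w ◃ q ⊰_)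
  after p q {v} {w} (step _ _ (f , _)) g r ⊰r with ◃⊰⁻ v p r ⊰r
  ... | r₀ , p⊰r₀ , refl = let s , q⊰s , z = f r₀ p⊰r₀ in
    w ◃ s , ◃-mono w q s q⊰s , ◃-cong k r₀ s (≈-mono (n≤1+n k) g) z
  before : ∀ p q {v w} → p ∼[ suc k ] q → v ≈[ suc k ] w → Forth _∼[ k ]_ (_⊰ v ◃ p) (_⊰ w ◃ q)
  before p q {v} {w} e@(step _ (f , _) _) g@(step (h , _)) r r⊰ with ⊰◃⁻ v p r r⊰
  ... | inj₁ (r₀ , r₀⊰p , refl) = let s , s⊰q , z = f r₀ r₀⊰p in
    w ◃ s , ◃-mono w s q s⊰q , ◃-cong k r₀ s (≈-mono (n≤1+n k) g) z
  ... | inj₂ (r₀ , v≡ , refl) with h r₀ v≡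
  ...   | s , refl , z = s ▹ word q , ▹⊰◃ s q , ▹-cong k r₀ s z (∼⇒≈ k p q (∼-mono (n≤1+n k) e))

≈-cong : ∀ k {u u′ v v′ : Word n} → u ≈[ k ] u′ → v ≈[ k ] v′ → u ++ v ≈[ k ] u′ ++ v′
≈-cong zero    _ _ = base
≈-cong (suc k) e f = step (F e f , F (≈-sym e) (≈-sym f))
  where
  F : ∀ {u u′ v v′} → u ≈[ suc k ] u′ → v ≈[ suc k ] v′ →
      Forth _∼[ k ]_ (λ p → u ++ v ≡ word p) (λ p → u′ ++ v′ ≡ word p)
  F {u} {u′} {v} {v′} e@(step (f , _)) g@(step (h , _)) p eq with word⁻ u v p eq
  ... | inj₁ (p₀ , u≡ , refl) with f p₀ u≡
  ...   | q , refl , z = q ▹ v′ , sym (word-▹ q v′) , ▹-cong k p₀ q z (≈-mono (n≤1+n k) g)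
  F {u} {u′} {v} {v′} e@(step (f , _)) g@(step (h , _)) p eq | inj₂ (p₀ , v≡ , refl) with h p₀ v≡
  ...   | q , refl , z = u′ ◃ q , sym (word-◃ u′ q) , ◃-cong k p₀ q (≈-mono (n≤1+n k) e) z

All-letter : ∀ {Q : Fin n → Set} (p : Pointed n) → All Q (word p) → Q (letter p)
All-letter (l ◁ _ ▷ _) = All.head ∘ All.++⁻ʳ l

All-tabulate : ∀ {Q : Fin n → Set} u → (∀ p → u ≡ word p → Q (letter p)) → All Q u
All-tabulate []      f = []
All-tabulate (a ∷ u) f =
  f ([] ◁ a ▷ u) refl ∷ All-tabulate u λ { (l ◁ c ▷ r) refl → f ((a ∷ l) ◁ c ▷ r) refl }

≈⇒All : ∀ {Q : Fin n → Set} → u ≈[ suc k ] v → All Q u → All Q v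
≈⇒All {u = u} {v = v} {Q = Q} (step (_ , f)) h = All-tabulate v λ p v≡ → let q , u≡ , z = f p v≡ in
  subst Q (sym (∼⇒letter≡ z)) (All-letter q (subst (All Q) u≡ h))

-- Pumping

module Pumping (B : Subset n) where

  Full : Word n → Set
  Full u = (B *) u × (∀ {c} → c Sub.∈ B → ∃[ p ] u ≡ word p × letter p ≡ c)

  -- Blocks are peeled off from the middle outwards: the outermost constructor holds the block
  -- adjacent to the middle, where Duplicator answers. What lies beyond the counted blocks is
  -- arbitrary.
  data Blocksˡ : ℕ → Word n → Set where
    none : Blocksˡ 0 x
    more : Blocksˡ k x → Full u → Blocksˡ (suc k) (x ++ u)

  data Blocksʳ : ℕ → Word n → Set where
    none : Blocksʳ 0 x
    more : Full u → Blocksʳ k x → Blocksʳ (suc k) (u ++ x)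

  Full-++ : Full u → Full v → Full (u ++ v)
  Full-++ {v = v} (a , f) (b , _) = All.++⁺ a b , λ c∈B → let p , u≡ , eq = f c∈B in
    p ▹ v , trans (cong (_++ v) u≡) (sym (word-▹ p v)) , eq

  -- The word stays the same, so a block is given up by merging it with its neighbour; a single
  -- block dissolves into the arbitrary remainder.
  weakenˡ : Blocksˡ (suc k) x → Blocksˡ k x
  weakenˡ (more none full) = none
  weakenˡ (more {u = u} (more {x = x} {u = u′} b full′) full) =
    subst (Blocksˡ _) (sym (++-assoc x u′ u)) (more b (Full-++ full′ full))

  weakenʳ : Blocksʳ (suc k) x → Blocksʳ k x
  weakenʳ (more full none) = none
  weakenʳ (more {u = u} full (more {u = u′} {x = x} full′ b)) =
    subst (Blocksʳ _) (++-assoc u u′ x) (more (Full-++ full full′) b)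

  -- The winning positions of Duplicator on u x v and u y v, where x, y ∈ B* and u, v contain
  -- one block with alphabet B per remaining round. A move of Spoiler inside x that cannot be
  -- copied is answered in the block next to y, which then becomes part of the middle.
  data Aligned : ℕ → Pointed n → Pointed n → Set where
    inˡ : Blocksˡ k (word p) → Blocksʳ k v → (B *) x → (B *) y →
          Aligned k (p ▹ (x ++ v)) (p ▹ (y ++ v))
    inʳ : Blocksˡ k u → Blocksʳ k (word p) → (B *) x → (B *) y →
          Aligned k ((u ++ x) ◃ p) ((u ++ y) ◃ p)
    inᵐ : Blocksˡ k u → Blocksʳ k v → (B *) (word p) → (B *) (word q) →
          letter p ≡ letter q → Aligned k (u ◃ p ▹ v) (u ◃ q ▹ v)

  Aligned-sym : Aligned k p q → Aligned k q p
  Aligned-sym (inˡ a b c d)   = inˡ a b d c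
  Aligned-sym (inʳ a b c d)   = inʳ a b d c
  Aligned-sym (inᵐ a b c d e) = inᵐ a b d c (sym e)

  Aligned⇒letter≡ : Aligned k p q → letter p ≡ letter q
  Aligned⇒letter≡ (inˡ _ _ _ _)   = refl
  Aligned⇒letter≡ (inʳ _ _ _ _)   = refl
  Aligned⇒letter≡ (inᵐ _ _ _ _ e) = e

  ⊰-* : p ⊰ q → (B *) (word q) → (B *) (word p)
  ⊰-* {p = p} {q = q} h = subst (B *) (sym (⊰⇒word≡ p q h))

  ⊰-*′ : p ⊰ q → (B *) (word p) → (B *) (word q)
  ⊰-*′ {p = p} {q = q} h = subst (B *) (⊰⇒word≡ p q h)

  *-▹ : ∀ (p : Pointed n) {v} → (B *) (word p) → (B *) v → (B *) (word (p ▹ v))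
  *-▹ p {v} a b = subst (B *) (sym (word-▹ p v)) (All.++⁺ a b)

  *-◃ : ∀ (p : Pointed n) {v} → (B *) v → (B *) (word p) → (B *) (word (v ◃ p))
  *-◃ p {v} a b = subst (B *) (sym (word-◃ v p)) (All.++⁺ a b)

  Aligned-before : Aligned (suc k) p q → Forth (Aligned k) (_⊰ p) (_⊰ q)
  Aligned-before (inˡ {p = p} {v} {x} {y} L V X Y) r r⊰ with ⊰▹⁻ p r (x ++ v) r⊰
  ... | r₀ , r₀⊰p , refl =
    r₀ ▹ (y ++ v) , ▹-mono r₀ p (y ++ v) r₀⊰p ,
    inˡ (subst (Blocksˡ _) (sym (⊰⇒word≡ r₀ p r₀⊰p)) (weakenˡ L)) (weakenʳ V) X Y
  Aligned-before (inʳ {u = u} {p} {x} {y} U L X Y) r r⊰ with ⊰◃⁻ (u ++ x) p r r⊰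
  ... | inj₁ (r₀ , r₀⊰p , refl) =
    (u ++ y) ◃ r₀ , ◃-mono (u ++ y) r₀ p r₀⊰p ,
    inʳ (weakenˡ U) (subst (Blocksʳ _) (sym (⊰⇒word≡ r₀ p r₀⊰p)) (weakenʳ L)) X Y
  ... | inj₂ (r₀ , eq , refl) with word⁻ u x r₀ eq
  ...   | inj₁ (r₁ , refl , refl) rewrite ▹-▹ r₁ x (word p) =
    r₁ ▹ (y ++ word p) ,
    subst₂ (λ s t → s ⊰ t ◃ p) (▹-▹ r₁ y (word p)) (word-▹ r₁ y) (▹⊰◃ (r₁ ▹ y) p) ,
    inˡ (weakenˡ U) (weakenʳ L) X Y
  ...   | inj₂ (r₁ , refl , refl) with U
  -- The letter played in `x` may be missing from `y`, and the answer has to stay before `p`. The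
  -- last block of `u` contains every letter of B; it joins both middles, which leaves `U₁` for the
  -- remaining rounds.
  ...     | more {x = u₁} U₁ (u∈ , f) with f (All-letter r₁ X)
  ...       | s , refl , s≡ =
    u₁ ◃ (s ▹ y) ▹ word p ,
    subst (λ t → (u₁ ◃ s ▹ y ▹ word p) ⊰ (t ◃ p))
      (trans (word-◃ u₁ (s ▹ y)) (trans (cong (u₁ ++_) (word-▹ s y)) (sym (++-assoc u₁ (word s) y))))
      (▹⊰◃ (u₁ ◃ s ▹ y) p) ,
    subst (λ t → Aligned _ (t ▹ word p) (u₁ ◃ (s ▹ y) ▹ word p)) (◃-◃ u₁ (word s) r₁)
      (inᵐ U₁ (weakenʳ L) (*-◃ r₁ u∈ X) (*-▹ s u∈ Y) (sym s≡))
  Aligned-before (inᵐ {u = u} {v} {p} {q} U V X Y e) r r⊰ with ⊰▹⁻ (u ◃ p) r v r⊰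
  ... | r₀ , r₀⊰ , refl with ⊰◃⁻ u p r₀ r₀⊰
  ...   | inj₂ (r₁ , refl , refl) =
    r₁ ▹ word q ▹ v , ▹-mono (r₁ ▹ word q) (word r₁ ◃ q) v (▹⊰◃ r₁ q) ,
    subst₂ (Aligned _) (sym (▹-▹ r₁ (word p) v)) (sym (▹-▹ r₁ (word q) v))
      (inˡ (weakenˡ U) (weakenʳ V) X Y)
  ...   | inj₁ (r₁ , r₁⊰p , refl) with U
  -- Within the middle this letter may not occur before `q`, so the answer again goes to the
  -- adjacent block on the left.
  ...     | more {x = u₁} U₁ (u∈ , f) with f (All-letter r₁ (⊰-* r₁⊰p X))
  ...       | s , refl , s≡ =
    u₁ ◃ (s ▹ word q) ▹ v ,
    subst (λ t → (u₁ ◃ (s ▹ word q) ▹ v) ⊰ t ▹ v) (◃-◃ u₁ (word s) q)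
      (▹-mono (u₁ ◃ s ▹ word q) (u₁ ◃ word s ◃ q) v (◃-mono u₁ (s ▹ word q) (word s ◃ q) (▹⊰◃ s q))) ,
    subst (λ t → Aligned _ (t ▹ v) (u₁ ◃ (s ▹ word q) ▹ v)) (◃-◃ u₁ (word s) r₁)
      (inᵐ U₁ (weakenʳ V) (*-◃ r₁ u∈ (⊰-* r₁⊰p X)) (*-▹ s u∈ Y) (sym s≡))

  Aligned-after : Aligned (suc k) p q → Forth (Aligned k) (p ⊰_) (q ⊰_)
  Aligned-after (inʳ {u = u} {p} {x} {y} U L X Y) r ⊰r with ◃⊰⁻ (u ++ x) p r ⊰r
  ... | r₀ , p⊰r₀ , refl =
    (u ++ y) ◃ r₀ , ◃-mono (u ++ y) p r₀ p⊰r₀ ,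
    inʳ (weakenˡ U) (subst (Blocksʳ _) (⊰⇒word≡ p r₀ p⊰r₀) (weakenʳ L)) X Y
  Aligned-after (inˡ {p = p} {v} {x} {y} L V X Y) r ⊰r with ▹⊰⁻ p r (x ++ v) ⊰r
  ... | inj₁ (r₀ , p⊰r₀ , refl) =
    r₀ ▹ (y ++ v) , ▹-mono p r₀ (y ++ v) p⊰r₀ ,
    inˡ (subst (Blocksˡ _) (⊰⇒word≡ p r₀ p⊰r₀) (weakenˡ L)) (weakenʳ V) X Y
  ... | inj₂ (r₀ , eq , refl) with word⁻ x v r₀ eq
  ...   | inj₂ (r₁ , refl , refl) =
    (word p ++ y) ◃ r₁ ,
    subst₂ (λ s t → (p ▹ s) ⊰ t) (word-◃ y r₁) (◃-◃ (word p) y r₁) (▹⊰◃ p (y ◃ r₁)) ,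
    subst (λ t → Aligned _ t ((word p ++ y) ◃ r₁)) (sym (◃-◃ (word p) x r₁))
      (inʳ (weakenˡ L) (weakenʳ V) X Y)
  ...   | inj₁ (r₁ , refl , refl) with V
  ...     | more {x = v₁} (v∈ , f) V₁ with f (All-letter r₁ X)
  ...       | s , refl , s≡ =
    word p ◃ (y ◃ s) ▹ v₁ ,
    subst (λ t → (p ▹ t) ⊰ (word p ◃ (y ◃ s) ▹ v₁))
      (trans (word-◃ y (s ▹ v₁)) (cong (y ++_) (word-▹ s v₁)))
      (▹⊰◃ p (y ◃ s ▹ v₁)) ,
    subst (λ t → Aligned _ (word p ◃ t) (word p ◃ (y ◃ s) ▹ v₁)) (▹-▹ r₁ (word s) v₁)
      (inᵐ (weakenˡ L) V₁ (*-▹ r₁ X v∈) (*-◃ s Y v∈) (sym s≡))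
  Aligned-after (inᵐ {u = u} {v} {p} {q} U V X Y e) r ⊰r with ◃⊰⁻ u (p ▹ v) r ⊰r
  ... | r₀ , ⊰r₀ , refl with ▹⊰⁻ p r₀ v ⊰r₀
  ...   | inj₂ (r₁ , refl , refl) =
    u ◃ word q ◃ r₁ , ◃-mono u (q ▹ word r₁) (word q ◃ r₁) (▹⊰◃ q r₁) ,
    subst₂ (Aligned _) (sym (◃-◃ u (word p) r₁)) (sym (◃-◃ u (word q) r₁))
      (inʳ (weakenˡ U) (weakenʳ V) X Y)
  ...   | inj₁ (r₁ , p⊰r₁ , refl) with V
  ...     | more {x = v₁} (v∈ , f) V₁ with f (All-letter r₁ (⊰-*′ p⊰r₁ X))
  ...       | s , refl , s≡ =
    u ◃ (word q ◃ s) ▹ v₁ ,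
    ◃-mono u (q ▹ (word s ++ v₁)) (word q ◃ s ▹ v₁)
      (subst (λ t → (q ▹ t) ⊰ (word q ◃ s ▹ v₁)) (word-▹ s v₁) (▹⊰◃ q (s ▹ v₁))) ,
    subst (λ t → Aligned _ (u ◃ t) (u ◃ (word q ◃ s) ▹ v₁)) (▹-▹ r₁ (word s) v₁)
      (inᵐ (weakenˡ U) V₁ (*-▹ r₁ (⊰-*′ p⊰r₁ X) v∈) (*-◃ s Y v∈) (sym s≡))

  Aligned⇒∼ : ∀ k → Aligned k p q → p ∼[ k ] q
  Aligned⇒∼ zero    z = base (Aligned⇒letter≡ z)
  Aligned⇒∼ (suc k) z = step (Aligned⇒letter≡ z)
    (F (Aligned-before z) , F (Aligned-before (Aligned-sym z)))
    (F (Aligned-after z) , F (Aligned-after (Aligned-sym z)))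
    where
    F : ∀ {X Y} → Forth (Aligned k) X Y → Forth _∼[ k ]_ X Y
    F = Forth-mono (Aligned⇒∼ k)

  pumping : ∀ k {u v x y} → Blocksˡ k u → Blocksʳ k v → (B *) x → (B *) y →
            u ++ x ++ v ≈[ k ] u ++ y ++ v
  pumping zero    _ _ _ _ = base
  pumping (suc k) {u} {v} {x} {y} U V X Y = step (F V X Y , F V Y X)
    where
    F : ∀ {v x y} → Blocksʳ (suc k) v → (B *) x → (B *) y →
        Forth _∼[ k ]_ (λ p → u ++ x ++ v ≡ word p) (λ p → u ++ y ++ v ≡ word p)
    F {v} {x} {y} V X Y p eq with word⁻ u (x ++ v) p eq
    ... | inj₁ (p₀ , refl , refl) =
      p₀ ▹ (y ++ v) , sym (word-▹ p₀ (y ++ v)) , Aligned⇒∼ k (inˡ (weakenˡ U) (weakenʳ V) X Y)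
    ... | inj₂ (p₀ , eq′ , refl) with word⁻ x v p₀ eq′
    ...   | inj₂ (p₁ , refl , refl) =
      (u ++ y) ◃ p₁ , sym (trans (word-◃ (u ++ y) p₁) (++-assoc u y (word p₁))) ,
      Aligned⇒∼ k (subst (λ t → Aligned _ t ((u ++ y) ◃ p₁)) (sym (◃-◃ u x p₁))
        (inʳ (weakenˡ U) (weakenʳ V) X Y))
    ...   | inj₁ (p₁ , refl , refl) with V
    -- No pebble constrains the first move: either adjacent block would do, and the one in `v` is
    -- used.
    ...     | more {x = v₁} (v∈ , f) V₁ with f (All-letter p₁ X)
    ...       | s , refl , s≡ =
      u ◃ (y ◃ s) ▹ v₁ ,
      sym (trans (word-◃ u (y ◃ s ▹ v₁)) (cong (u ++_)
        (trans (word-◃ y (s ▹ v₁)) (cong (y ++_) (word-▹ s v₁))))) ,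
      Aligned⇒∼ k (subst (λ t → Aligned _ (u ◃ t) (u ◃ (y ◃ s) ▹ v₁)) (▹-▹ p₁ (word s) v₁)
        (inᵐ (weakenˡ U) V₁ (*-▹ p₁ X v∈) (*-◃ s Y v∈) (sym s≡)))

-- Cutting words at a letter

infix 4 _∌_
_∌_ : Word n → Fin n → Set
u ∌ b = All (_≢ b) u

letter-∌ : ∀ (p : Pointed n) {b} → word p ∌ b → letter p ≢ b
letter-∌ p = All-letter p

∌-⊰ : ∀ (p q : Pointed n) {b} → p ⊰ q → word q ∌ b → word p ∌ b
∌-⊰ p q {b} h = subst (_∌ b) (sym (⊰⇒word≡ p q h))

∌-⊱ : ∀ (p q : Pointed n) {b} → p ⊰ q → word p ∌ b → word q ∌ b
∌-⊱ p q {b} h = subst (_∌ b) (⊰⇒word≡ p q h)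

-- A move past the first b is detected one round later, by a move back to this b.
cut-after : ∀ {b : Fin n} {v w} k (p q : Pointed n) → word p ∌ b → word q ∌ b →
            (p ▹ (b ∷ v)) ∼[ suc k ] (q ▹ (b ∷ w)) → p ∼[ k ] q
cut-after zero    p q _ _ e = base (∼⇒letter≡ e)
cut-after {b = b} (suc k) p q p∌ q∌ e =
  step (∼⇒letter≡ e) (before p q p∌ q∌ e , before q p q∌ p∌ (∼-sym e))
                     (after p q p∌ q∌ e , after q p q∌ p∌ (∼-sym e))
  where
  before : ∀ p q {v w} → word p ∌ b → word q ∌ b →
           (p ▹ (b ∷ v)) ∼[ suc (suc k) ] (q ▹ (b ∷ w)) → Forth _∼[ k ]_ (_⊰ p) (_⊰ q)
  before p q {v} {w} p∌ q∌ (step _ (f , _) _) r r⊰p with f (r ▹ (b ∷ v)) (▹-mono r p (b ∷ v) r⊰p)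
  ... | s , s⊰ , z with ⊰▹⁻ q s (b ∷ w) s⊰
  ...   | s₀ , s₀⊰q , refl = s₀ , s₀⊰q , cut-after k r s₀ (∌-⊰ r p r⊰p p∌) (∌-⊰ s₀ q s₀⊰q q∌) z

  after : ∀ p q {v w} → word p ∌ b → word q ∌ b →
          (p ▹ (b ∷ v)) ∼[ suc (suc k) ] (q ▹ (b ∷ w)) → Forth _∼[ k ]_ (p ⊰_) (q ⊰_)
  after p q {v} {w} p∌ q∌ (step _ _ (f , _)) r p⊰r with f (r ▹ (b ∷ v)) (▹-mono p r (b ∷ v) p⊰r)
  ... | s , ⊰s , z with ▹⊰⁻ q s (b ∷ w) ⊰s
  ...   | inj₁ (s₀ , q⊰s₀ , refl) =
    s₀ , q⊰s₀ , cut-after k r s₀ (∌-⊱ p r p⊰r p∌) (∌-⊱ q s₀ q⊰s₀ q∌) z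
  ...   | inj₂ ([] ◁ _ ▷ _ , refl , refl) =
    ⊥-elim (letter-∌ r (∌-⊱ p r p⊰r p∌) (∼⇒letter≡ z))
  ...   | inj₂ ((_ ∷ l) ◁ _ ▷ _ , refl , refl) with z
  ...     | step _ (_ , g) _ with g (word q ◁ b ▷ (l ++ _ ∷ _)) (l , refl , refl)
  ...       | t , t⊰ , z′ with ⊰▹⁻ r t (b ∷ v) t⊰
  ...         | t₀ , t₀⊰r , refl =
    ⊥-elim (letter-∌ t₀ (∌-⊰ t₀ r t₀⊰r (∌-⊱ p r p⊰r p∌)) (sym (∼⇒letter≡ z′)))

-- This is not the mirror image of `cut-after`: `p` and `q` may contain `b`, and only the prefixes
-- avoid it. An answer inside `v ++ [ b ]` loses to a move onto the `b` that follows `u`, because no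
-- `b` lies strictly before a position of `v ++ [ b ]`.
cut-before : ∀ {b : Fin n} {u v} k (p q : Pointed n) → u ∌ b → v ∌ b →
             ((u ++ [ b ]) ◃ p) ∼[ suc k ] ((v ++ [ b ]) ◃ q) → p ∼[ k ] q
cut-before zero    p q _ _ e = base (∼⇒letter≡ e)
cut-before {n = n} {b = b} (suc k) p q u∌ v∌ e =
  step (∼⇒letter≡ e) (before p q u∌ v∌ e , before q p v∌ u∌ (∼-sym e))
                     (after p q u∌ v∌ e , after q p v∌ u∌ (∼-sym e))
  where
  ∌-left : ∀ (s s′ : Pointed n) {v : Word n} → v ∌ b → v ++ [ b ] ≡ word s → s′ ⊰ s → letter s′ ≢ b
  ∌-left s s′ {v} v∌ eq (m , eq′ , _) with split-++ v [ b ] (left s) eq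
  ... | inj₁ (m′ , refl , refl) =
    letter-∌ (left s′ ◁ letter s′ ▷ m) (subst (_∌ b) eq′ (All.++⁻ˡ (left s) v∌))
  ... | inj₂ ([] , h , refl) =
    letter-∌ (left s′ ◁ letter s′ ▷ m) (subst (_∌ b) (trans (sym (trans h (++-identityʳ v))) eq′) v∌)
  ... | inj₂ (_ ∷ [] , h , ())
  ... | inj₂ (_ ∷ _ ∷ _ , h , ())

  after : ∀ p q {u v} → u ∌ b → v ∌ b →
          ((u ++ [ b ]) ◃ p) ∼[ suc (suc k) ] ((v ++ [ b ]) ◃ q) → Forth _∼[ k ]_ (p ⊰_) (q ⊰_)
  after p q {u} {v} u∌ v∌ (step _ _ (f , _)) r p⊰r
    with f ((u ++ [ b ]) ◃ r) (◃-mono (u ++ [ b ]) p r p⊰r)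
  ... | s , ⊰s , z with ◃⊰⁻ (v ++ [ b ]) q s ⊰s
  ...   | s₀ , q⊰s₀ , refl = s₀ , q⊰s₀ , cut-before k r s₀ u∌ v∌ z

  before : ∀ p q {u v} → u ∌ b → v ∌ b →
           ((u ++ [ b ]) ◃ p) ∼[ suc (suc k) ] ((v ++ [ b ]) ◃ q) → Forth _∼[ k ]_ (_⊰ p) (_⊰ q)
  before p q {u} {v} u∌ v∌ (step _ (f , _) _) r r⊰p
    with f ((u ++ [ b ]) ◃ r) (◃-mono (u ++ [ b ]) r p r⊰p)
  ... | s , s⊰ , z with ⊰◃⁻ (v ++ [ b ]) q s s⊰
  ...   | inj₁ (s₀ , s₀⊰q , refl) = s₀ , s₀⊰q , cut-before k r s₀ u∌ v∌ z
  ...   | inj₂ (s₀ , eq , refl) with z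
  ...     | step _ (g , _) _
    with g (u ◁ b ▷ word r) (left r , ++-assoc u [ b ] (left r) , refl)
  ...       | t , t⊰ , z′ with ⊰▹⁻ s₀ t (word q) t⊰
  ...         | t₀ , t₀⊰s₀ , refl = ⊥-elim (∌-left s₀ t₀ v∌ eq t₀⊰s₀ (sym (∼⇒letter≡ z′)))

-- One round pebbles the first `b`; the answer is a first occurrence too, since an earlier `b` would
-- need a counterpart in `u`. A second round is lost in `cut-after` or `cut-before`. The factors
-- then agree for `suc k` rounds, and dropping one more spares a case distinction on `k`.
splits-at-first : ∀ {b : Fin n} {u v w} k → u ∌ b → u ++ b ∷ v ≈[ 3 ℕ.+ k ] w →
                  ∃₂ λ u′ v′ → w ≡ u′ ++ b ∷ v′ × u′ ∌ b × u ≈[ k ] u′ × v ≈[ k ] v′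
splits-at-first {b = b} {u} {v} k u∌ (step (f , _)) with f (u ◁ b ▷ v) refl
... | q@(u′ ◁ _ ▷ v′) , refl , z with ∼⇒letter≡ z
...   | refl =
  u′ , v′ , refl , u′∌ z , ≈-mono (n≤1+n k) (step (F u∌ (u′∌ z) z , F (u′∌ z) u∌ (∼-sym z))) ,
  ≈-mono (n≤1+n k) (step (G u∌ (u′∌ z) z , G (u′∌ z) u∌ (∼-sym z)))
  where
  u′∌ : ∀ {u′ v′} → u ◁ b ▷ v ∼[ 2 ℕ.+ k ] u′ ◁ b ▷ v′ → u′ ∌ b
  u′∌ {u′} {v′} (step _ (_ , g) _) = All-tabulate u′ λ p u′≡ p≡b →
    let q , (m , u≡ , _) , z = g (p ▹ (b ∷ v′)) (right p , u′≡ , refl) in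
    letter-∌ (left q ◁ letter q ▷ m) (subst (_∌ b) u≡ u∌) (trans (sym (∼⇒letter≡ z)) p≡b)
  F : ∀ {u u′ v v′} → u ∌ b → u′ ∌ b → u ◁ b ▷ v ∼[ 2 ℕ.+ k ] u′ ◁ b ▷ v′ →
      Forth _∼[ k ]_ (λ p → u ≡ word p) (λ p → u′ ≡ word p)
  F {v = v} u∌ u′∌ (step _ (f , _) _) p refl with f (p ▹ (b ∷ v)) (right p , refl , refl)
  ... | (l ◁ c ▷ _) , (m , refl , refl) , z =
    l ◁ c ▷ m , refl , cut-after k p (l ◁ c ▷ m) u∌ u′∌ z
  G : ∀ {u u′ v v′} → u ∌ b → u′ ∌ b → u ◁ b ▷ v ∼[ 2 ℕ.+ k ] u′ ◁ b ▷ v′ →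
      Forth _∼[ k ]_ (λ p → v ≡ word p) (λ p → v′ ≡ word p)
  G {u = u} {u′} u∌ u′∌ (step _ _ (f , _)) p refl
    with f ((u ++ [ b ]) ◃ p) (left p , ++-assoc u [ b ] (left p) , refl)
  ... | (_ ◁ c ▷ r) , (m , refl , refl) , z =
    m ◁ c ▷ r , refl ,
    cut-before k p (m ◁ c ▷ r) u∌ u′∌
      (subst (λ t → _ ∼[ suc k ] t ◁ c ▷ r) (sym (++-assoc u′ [ b ] m)) z)

-- Invariance of the game under reversal, and the cut at a last occurrence

reverseᵖ-∼ : ∀ k (p q : Pointed n) → p ∼[ k ] q → reverseᵖ p ∼[ k ] reverseᵖ q
reverseᵖ-∼ zero    p q (base e) = base e
reverseᵖ-∼ (suc k) p q (step e (a , b) (c , d)) =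
  step e (before p q c , before q p d) (after p q a , after q p b)
  where
  before : ∀ p q → Forth _∼[ k ]_ (p ⊰_) (q ⊰_) → Forth _∼[ k ]_ (_⊰ reverseᵖ p) (_⊰ reverseᵖ q)
  before p q f r r⊰ =
    let s , q⊰s , z = f (reverseᵖ r) (subst (_⊰ reverseᵖ r) (reverseᵖ-involutive p) (reverseᵖ-⊰ r (reverseᵖ p) r⊰))
    in reverseᵖ s , reverseᵖ-⊰ q s q⊰s ,
       subst (_∼[ k ] reverseᵖ s) (reverseᵖ-involutive r) (reverseᵖ-∼ k (reverseᵖ r) s z)
  after : ∀ p q → Forth _∼[ k ]_ (_⊰ p) (_⊰ q) → Forth _∼[ k ]_ (reverseᵖ p ⊰_) (reverseᵖ q ⊰_)
  after p q f r ⊰r =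
    let s , s⊰q , z = f (reverseᵖ r) (subst (reverseᵖ r ⊰_) (reverseᵖ-involutive p) (reverseᵖ-⊰ (reverseᵖ p) r ⊰r))
    in reverseᵖ s , reverseᵖ-⊰ s q s⊰q ,
       subst (_∼[ k ] reverseᵖ s) (reverseᵖ-involutive r) (reverseᵖ-∼ k (reverseᵖ r) s z)

word-reverseᵖ : ∀ (p : Pointed n) → word (reverseᵖ p) ≡ reverse (word p)
word-reverseᵖ (l ◁ a ▷ r) = sym (reverse-pivot l a r)

reverse-≈ : ∀ k (u v : Word n) → u ≈[ k ] v → reverse u ≈[ k ] reverse v
reverse-≈ zero    u v _ = base
reverse-≈ (suc k) u v (step (f , g)) = step (F u v f , F v u g)
  where
  F : ∀ u v → Forth _∼[ k ]_ (λ p → u ≡ word p) (λ p → v ≡ word p) →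
      Forth _∼[ k ]_ (λ p → reverse u ≡ word p) (λ p → reverse v ≡ word p)
  F u v f p eq =
    let q , v≡ , z = f (reverseᵖ p) (trans (sym (reverse-involutive u))
                       (trans (cong reverse eq) (sym (word-reverseᵖ p))))
    in reverseᵖ q , trans (cong reverse v≡) (sym (word-reverseᵖ q)) ,
       subst (_∼[ k ] reverseᵖ q) (reverseᵖ-involutive p) (reverseᵖ-∼ k (reverseᵖ p) q z)

reverse-All : ∀ {Q : Fin n → Set} u → All Q u → All Q (reverse u)
reverse-All []      []      = []
reverse-All {Q = Q} (a ∷ u) (h ∷ t) =
  subst (All Q) (sym (unfold-reverse a u)) (All.++⁺ (reverse-All u t) (h ∷ []))

splits-at-last : ∀ {b : Fin n} {u v w} k → v ∌ b → u ++ b ∷ v ≈[ 3 ℕ.+ k ] w →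
                 ∃₂ λ u′ v′ → w ≡ u′ ++ b ∷ v′ × v′ ∌ b × u ≈[ k ] u′ × v ≈[ k ] v′
splits-at-last {b = b} {u} {v} {w} k v∌ e
  with splits-at-first {u = reverse v} {reverse u} k (reverse-All v v∌)
         (subst (_≈[ 3 ℕ.+ k ] reverse w) (reverse-pivot u b v) (reverse-≈ _ (u ++ b ∷ v) w e))
... | v′ , u′ , w≡ , v′∌ , e₁ , e₂ =
  reverse u′ , reverse v′ ,
  trans (sym (reverse-involutive w)) (trans (cong reverse w≡) (reverse-pivot v′ b u′)) ,
  reverse-All v′ v′∌ ,
  subst (_≈[ k ] reverse u′) (reverse-involutive u) (reverse-≈ k (reverse u) u′ e₂) ,
  subst (_≈[ k ] reverse v′) (reverse-involutive v) (reverse-≈ k (reverse v) v′ e₁)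

first-occurrence : ∀ (b : Fin n) w → w ∌ b ⊎ ∃₂ λ u v → w ≡ u ++ b ∷ v × u ∌ b
first-occurrence b [] = inj₁ []
first-occurrence b (a ∷ w) with a ≟ b | first-occurrence b w
... | yes refl | _                            = inj₂ ([] , w , refl , [])
... | no a≢b   | inj₁ w∌                      = inj₁ (a≢b ∷ w∌)
... | no a≢b   | inj₂ (u , v , refl , u∌)     = inj₂ (a ∷ u , v , refl , a≢b ∷ u∌)

last-occurrence : ∀ (b : Fin n) w → w ∌ b ⊎ ∃₂ λ u v → w ≡ u ++ b ∷ v × v ∌ b
last-occurrence b [] = inj₁ []
last-occurrence b (a ∷ w) with last-occurrence b w | a ≟ b
... | inj₂ (u , v , refl , v∌) | _        = inj₂ (a ∷ u , v , refl , v∌)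
... | inj₁ w∌                  | yes refl = inj₂ ([] , w , refl , w∌)
... | inj₁ w∌                  | no a≢b   = inj₁ (a≢b ∷ w∌)

-- Formulas and games

at : (w : Word n) → Position w → Pointed n
at (a ∷ w) zero    = [] ◁ a ▷ w
at (a ∷ w) (suc i) = [ a ] ◃ at w i

letter-at : ∀ (w : Word n) i → letter (at w i) ≡ lookup w i
letter-at (a ∷ w) zero    = refl
letter-at (a ∷ w) (suc i) = letter-at w i

word-at : ∀ (w : Word n) i → w ≡ word (at w i)
word-at (a ∷ w) zero    = refl
word-at (a ∷ w) (suc i) = cong (a ∷_) (word-at w i)

length-left-at : ∀ (w : Word n) i → length (left (at w i)) ≡ toℕ i
length-left-at (a ∷ w) zero    = refl
length-left-at (a ∷ w) (suc i) = cong suc (length-left-at w i)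

at-surjective : ∀ (w : Word n) p → w ≡ word p → ∃[ i ] at w i ≡ p
at-surjective _ ([] ◁ a ▷ r)    refl = zero , refl
at-surjective _ ((a ∷ l) ◁ c ▷ r) refl with at-surjective _ (l ◁ c ▷ r) refl
... | i , eq = suc i , cong ([ a ] ◃_) eq

<⇒⊰ : ∀ (w : Word n) i j → i Fin.< j → at w i ⊰ at w j
<⇒⊰ (a ∷ w) zero    (suc j) _         = left (at w j) , refl , word-at w j
<⇒⊰ (a ∷ w) (suc i) (suc j) (s≤s i<j) = ◃-mono [ a ] (at w i) (at w j) (<⇒⊰ w i j i<j)

⊰⇒< : ∀ (w : Word n) i j → at w i ⊰ at w j → i Fin.< j
⊰⇒< w i j (m , eq , _) = subst₂ ℕ._<_ (length-left-at w i)
  (trans (sym (length-++ (left (at w i)))) (trans (cong length (sym eq)) (length-left-at w j)))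
  (m<m+n _ (s≤s z≤n))

module _ {w w′ : Word n} where

  private
    respond : {P P′ : Pointed n → Set} {X : Position w → Set} {X′ : Position w′ → Set} →
              (∀ {q} → P′ q → w′ ≡ word q) → (∀ i → X i → P (at w i)) → (∀ i → P′ (at w′ i) → X′ i) →
              Forth _∼[ k ]_ P P′ → ∀ i → X i → ∃[ i′ ] X′ i′ × at w i ∼[ k ] at w′ i′
    respond total f g h i x with h (at w i) (f i x)
    ... | q , hq , z with at-surjective w′ q (total hq)
    ...   | i′ , refl = i′ , g i′ hq , z

  answer : w ≈[ suc k ] w′ → ∀ i → ∃[ i′ ] at w i ∼[ k ] at w′ i′
  answer (step (f , _)) i =
    let i′ , _ , z = respond {X = λ _ → ⊤} {λ _ → ⊤} id (λ i _ → word-at w i) _ f i tt in i′ , z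

  answer-< : ∀ {j j′} → at w j ∼[ suc k ] at w′ j′ →
             ∀ i → i Fin.< j → ∃[ i′ ] i′ Fin.< j′ × at w i ∼[ k ] at w′ i′
  answer-< {j = j} {j′} (step _ (f , _) _) = respond
    (λ {q} h → trans (word-at w′ j′) (sym (⊰⇒word≡ q (at w′ j′) h)))
    (λ i → <⇒⊰ w i j) (λ i → ⊰⇒< w′ i j′) f

  answer-> : ∀ {j j′} → at w j ∼[ suc k ] at w′ j′ →
             ∀ i → j Fin.< i → ∃[ i′ ] j′ Fin.< i′ × at w i ∼[ k ] at w′ i′
  answer-> {j = j} {j′} (step _ _ (f , _)) = respond
    (λ {q} h → trans (word-at w′ j′) (⊰⇒word≡ (at w′ j′) q h))
    (λ i → <⇒⊰ w j i) (λ i → ⊰⇒< w′ j′ i) f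

  -- The way back from `respond`: answers given on indices are turned into a match on pointed words,
  -- as the Hintikka formulas require.
  Forth-at : {X : Position w → Set} {X′ : Position w′ → Set} {P P′ : Pointed n → Set} →
             (∀ {p} → P p → w ≡ word p) → (∀ i → P (at w i) → X i) → (∀ i → X′ i → P′ (at w′ i)) →
             (∀ i → X i → ∃[ i′ ] X′ i′ × at w i ∼[ k ] at w′ i′) → Forth _∼[ k ]_ P P′
  Forth-at total f g h p hp with at-surjective w p (total hp)
  ... | i , refl = let i′ , x′ , z = h i (f i hp) in at w′ i′ , g i′ x′ , z

rank : Formula n 2 → ℕ
rank (P _ _)   = 0
rank (_ ≺ _)   = 0
rank (_ ≋ _)   = 0
rank (neg φ)   = rank φ
rank (φ and ψ) = rank φ ℕ.⊔ rank ψ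
rank (φ or ψ)  = rank φ ℕ.⊔ rank ψ
rank (ex _ φ)  = suc (rank φ)
rank (all _ φ) = suc (rank φ)

SameOrder : Fin k → Fin k → Fin l → Fin l → Set
SameOrder i j i′ j′ =
  (i Fin.< j × i′ Fin.< j′) ⊎ (i ≡ j × i′ ≡ j′) ⊎ (j Fin.< i × j′ Fin.< i′)

SameOrder-flip : {i j : Fin k} {i′ j′ : Fin l} → SameOrder i j i′ j′ → SameOrder j i j′ i′
SameOrder-flip (inj₁ h)                    = inj₂ (inj₂ h)
SameOrder-flip (inj₂ (inj₁ (refl , refl))) = inj₂ (inj₁ (refl , refl))
SameOrder-flip (inj₂ (inj₂ h))             = inj₁ h

SameOrder-sym : {i j : Fin k} {i′ j′ : Fin l} → SameOrder i j i′ j′ → SameOrder i′ j′ i j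
SameOrder-sym = Sum.map swap (Sum.map swap swap)

-- In `both`, each pebble keeps its full `k` rounds, since either variable may be requantified next
-- and the survivor then constrains the move.
data Agree {n} (k : ℕ) (w w′ : Word n) : (s t : Maybe (Position w)) (s′ t′ : Maybe (Position w′)) → Set where
  none  : Agree k w w′ nothing nothing nothing nothing
  fst   : ∀ {i i′} → at w i ∼[ k ] at w′ i′ → Agree k w w′ (just i) nothing (just i′) nothing
  snd   : ∀ {i i′} → at w i ∼[ k ] at w′ i′ → Agree k w w′ nothing (just i) nothing (just i′)
  both  : ∀ {i i′ j j′} → at w i ∼[ k ] at w′ i′ → at w j ∼[ k ] at w′ j′ →
          SameOrder i j i′ j′ → Agree k w w′ (just i) (just j) (just i′) (just j′)

Agree-sym : ∀ {w w′ : Word n} {s t s′ t′} → Agree k w w′ s t s′ t′ → Agree k w′ w s′ t′ s t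
Agree-sym none         = none
Agree-sym (fst e)      = fst (∼-sym e)
Agree-sym (snd e)      = snd (∼-sym e)
Agree-sym (both e f o) = both (∼-sym e) (∼-sym f) (SameOrder-sym o)

Agree-flip : ∀ {w w′ : Word n} {s t s′ t′} → Agree k w w′ s t s′ t′ → Agree k w w′ t s t′ s′
Agree-flip none         = none
Agree-flip (fst e)      = snd e
Agree-flip (snd e)      = fst e
Agree-flip (both e f o) = both f e (SameOrder-flip o)

Agree-lookup : ∀ {w w′ : Word n} {s t s′ t′} → Agree k w w′ s t s′ t′ → ∀ x {i} →
               Vec.lookup (s ∷ t ∷ []) x ≡ just i →
               ∃[ i′ ] Vec.lookup (s′ ∷ t′ ∷ []) x ≡ just i′ × at w i ∼[ k ] at w′ i′
Agree-lookup (fst e)      zero       refl = _ , refl , e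
Agree-lookup (snd e)      (suc zero) refl = _ , refl , e
Agree-lookup (both e _ _) zero       refl = _ , refl , e
Agree-lookup (both _ e _) (suc zero) refl = _ , refl , e

Agree-order : ∀ {w w′ : Word n} {s t s′ t′} → Agree k w w′ s t s′ t′ → ∀ x y {i j i′ j′} →
              Vec.lookup (s ∷ t ∷ []) x ≡ just i → Vec.lookup (s ∷ t ∷ []) y ≡ just j →
              Vec.lookup (s′ ∷ t′ ∷ []) x ≡ just i′ → Vec.lookup (s′ ∷ t′ ∷ []) y ≡ just j′ →
              SameOrder i j i′ j′
Agree-order (fst _)      zero       zero       refl refl refl refl = inj₂ (inj₁ (refl , refl))
Agree-order (fst _)      zero       (suc zero) refl ()
Agree-order (snd _)      (suc zero) (suc zero) refl refl refl refl = inj₂ (inj₁ (refl , refl))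
Agree-order (both _ _ _) zero       zero       refl refl refl refl = inj₂ (inj₁ (refl , refl))
Agree-order (both _ _ _) (suc zero) (suc zero) refl refl refl refl = inj₂ (inj₁ (refl , refl))
Agree-order (both _ _ o) zero       (suc zero) refl refl refl refl = o
Agree-order (both _ _ o) (suc zero) zero       refl refl refl refl = SameOrder-flip o

module _ {w w′ : Word n} where

  private
    with-other : ∀ {j j′} → at w j ∼[ suc k ] at w′ j′ →
                 ∀ i → ∃[ i′ ] Agree k w w′ (just i) (just j) (just i′) (just j′)
    with-other {k} {j = j} {j′} e i with <-cmp i j
    ... | tri< i<j _ _  = let i′ , lt , z = answer-< {w = w} {w′} e i i<j in
      i′ , both z (∼-mono (n≤1+n k) e) (inj₁ (i<j , lt))
    ... | tri≈ _ refl _ =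
      j′ , both (∼-mono (n≤1+n k) e) (∼-mono (n≤1+n k) e) (inj₂ (inj₁ (refl , refl)))
    ... | tri> _ _ i>j  = let i′ , gt , z = answer-> {w = w} {w′} e i i>j in
      i′ , both z (∼-mono (n≤1+n k) e) (inj₂ (inj₂ (i>j , gt)))

  -- The requantified variable gives up its position, so at most one pebble constrains the move.
  -- This is where having only two variables is used: with no other pebble `w ≈[ suc k ] w′`
  -- answers, with one other pebble its own strategy does.
  move : ∀ {s t s′ t′} → w ≈[ suc k ] w′ → Agree (suc k) w w′ s t s′ t′ →
         ∀ i → ∃[ i′ ] Agree k w w′ (just i) t (just i′) t′
  move e none         i = map₂ fst (answer e i)
  move e (fst _)      i = map₂ fst (answer e i)
  move e (snd f)      i = with-other f i
  move e (both _ f _) i = with-other f i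

agreement : ∀ {w w′ : Word n} k φ {s t s′ t′} → rank φ ℕ.≤ k → w ≈[ k ] w′ →
            Agree k w w′ s t s′ t′ → w , s ∷ t ∷ [] ⊨ φ → w′ , s′ ∷ t′ ∷ [] ⊨ φ
agreement {w = w} {w′} k (P a x) r e A (i , i≡ , refl) =
  let i′ , i′≡ , z = Agree-lookup A x i≡ in
  i′ , i′≡ , trans (sym (letter-at w′ i′)) (trans (sym (∼⇒letter≡ z)) (letter-at w i))
agreement k (x ≺ y) r e A (i , j , i≡ , j≡ , i<j)
  with Agree-lookup A x i≡ | Agree-lookup A y j≡
... | i′ , i′≡ , _ | j′ , j′≡ , _ with Agree-order A x y i≡ j≡ i′≡ j′≡
...   | inj₁ (_ , i′<j′)        = i′ , j′ , i′≡ , j′≡ , i′<j′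
...   | inj₂ (inj₁ (refl , _))  = ⊥-elim (<-irrefl refl i<j)
...   | inj₂ (inj₂ (j<i , _))   = ⊥-elim (ℕ.<-asym i<j j<i)
agreement k (x ≋ y) r e A (i , j , i≡ , j≡ , refl)
  with Agree-lookup A x i≡ | Agree-lookup A y j≡
... | i′ , i′≡ , _ | j′ , j′≡ , _ with Agree-order A x y i≡ j≡ i′≡ j′≡
...   | inj₁ (i<i , _)              = ⊥-elim (<-irrefl refl i<i)
...   | inj₂ (inj₁ (_ , i′≡j′))     = i′ , j′ , i′≡ , j′≡ , i′≡j′
...   | inj₂ (inj₂ (i<i , _))       = ⊥-elim (<-irrefl refl i<i)
agreement k (neg φ)   r e A h = λ h′ → h (agreement k φ r (≈-sym e) (Agree-sym A) h′)
agreement k (φ and ψ) r e A (h , h′) =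
  agreement k φ (≤-trans (m≤m⊔n _ _) r) e A h , agreement k ψ (≤-trans (m≤n⊔m (rank φ) _) r) e A h′
agreement k (φ or ψ)  r e A (inj₁ h) = inj₁ (agreement k φ (≤-trans (m≤m⊔n _ _) r) e A h)
agreement k (φ or ψ)  r e A (inj₂ h) = inj₂ (agreement k ψ (≤-trans (m≤n⊔m (rank φ) _) r) e A h)
agreement (suc k) (ex zero φ) (s≤s r) e A (i , h) =
  let i′ , A′ = move e A i in i′ , agreement k φ r (≈-mono (n≤1+n k) e) A′ h
agreement (suc k) (ex (suc zero) φ) (s≤s r) e A (i , h) =
  let i′ , A′ = move e (Agree-flip A) i in i′ , agreement k φ r (≈-mono (n≤1+n k) e) (Agree-flip A′) h
agreement (suc k) (all zero φ) (s≤s r) e A h i′ =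
  let i , A′ = move (≈-sym e) (Agree-sym A) i′ in
  agreement k φ r (≈-mono (n≤1+n k) e) (Agree-sym A′) (h i)
agreement (suc k) (all (suc zero) φ) (s≤s r) e A h i′ =
  let i , A′ = move (≈-sym e) (Agree-flip (Agree-sym A)) i′ in
  agreement k φ r (≈-mono (n≤1+n k) e) (Agree-sym (Agree-flip A′)) (h i)

≈⇒⊨ : ∀ (φ : Formula n 2) → w ≈[ rank φ ] w′ → w ⊨ φ → w′ ⊨ φ
≈⇒⊨ φ e = agreement _ φ ≤-refl e none

-- Hintikka formulas

infix 4 _∉free_
_∉free_ : Fin k → Formula n k → Set
x ∉free φ = x Sub.∉ freeVars φ

∉free-and : ∀ {x : Fin k} (φ ψ : Formula n k) → x ∉free φ → x ∉free ψ → x ∉free (φ and ψ)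
∉free-and φ ψ h h′ = [ h , h′ ]′ ∘ Sub.x∈p∪q⁻ (freeVars φ) (freeVars ψ)

x∉p-x : ∀ (p : Sub.Subset k) x → x Sub.∉ p Sub.- x
x∉p-x (_ ∷ p)       zero    ()
x∉p-x (_ ∷ p)       (suc x) (there h) = x∉p-x p x h

-- A universal formula, so as to be closed and to hold in the empty word as well, where every `ex`
-- fails.
verum : Formula n 2
verum = all zero (zero ≋ zero)

verum-closed : ∀ x → x ∉free verum {n}
verum-closed zero       ()
verum-closed (suc zero) (there ())

⊨-verum : ∀ {w : Word n} {σ} → w , σ ⊨ verum
⊨-verum {σ = _ ∷ _} i = i , i , refl , refl , refl

-- The sign conjunctions over the given list, that is, the atoms of the Boolean algebra it generates
-- together with some contradictions. Keeping the contradictory ones avoids any decision about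
-- satisfiability.
cells : List (Formula n 2) → List (Formula n 2)
cells []      = verum ∷ []
cells (φ ∷ Φ) = map (φ and_) (cells Φ) ++ map (neg φ and_) (cells Φ)

cells-∉free : ∀ {x} (Φ : List (Formula n 2)) → All (x ∉free_) Φ → All (x ∉free_) (cells Φ)
cells-∉free {n = n} {x} [] [] = verum-closed {n = n} x ∷ []
cells-∉free (φ ∷ Φ) (h ∷ hs) = All.++⁺ (All.map⁺ (All.map (λ {ψ} → ∉free-and φ ψ h) (cells-∉free Φ hs)))
                                       (All.map⁺ (All.map (λ {ψ} → ∉free-and (neg φ) ψ h) (cells-∉free Φ hs)))

cells-agree : ∀ {w w′ : Word n} {σ σ′} Φ {τ} → τ List.∈ cells Φ → w , σ ⊨ τ → w′ , σ′ ⊨ τ →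
              ∀ {φ} → φ List.∈ Φ → w , σ ⊨ φ → w′ , σ′ ⊨ φ
cells-agree (φ ∷ Φ) τ∈ h h′ ψ∈ with ∈-++⁻ (map (φ and_) (cells Φ)) τ∈
... | inj₁ m with ∈-map⁻ (φ and_) m
cells-agree (φ ∷ Φ) τ∈ h h′ (here refl) | inj₁ m | _ , _ , refl = λ _ → proj₁ h′
cells-agree (φ ∷ Φ) τ∈ h h′ (there ψ∈)  | inj₁ m | _ , t , refl = cells-agree Φ t (proj₂ h) (proj₂ h′) ψ∈
cells-agree (φ ∷ Φ) τ∈ h h′ ψ∈ | inj₂ m with ∈-map⁻ (neg φ and_) m
cells-agree (φ ∷ Φ) τ∈ h h′ (here refl) | inj₂ m | _ , _ , refl = λ hφ → ⊥-elim (proj₁ h hφ)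
cells-agree (φ ∷ Φ) τ∈ h h′ (there ψ∈)  | inj₂ m | _ , t , refl = cells-agree Φ t (proj₂ h) (proj₂ h′) ψ∈

-- Excluded middle is a parameter because it only becomes available with the rating map.
module Hintikka (lem : (X : Set) → Dec X) {n : ℕ} where

  cells-cover : ∀ {w : Word n} {σ} Φ → ∃[ τ ] τ List.∈ cells Φ × w , σ ⊨ τ
  cells-cover {w} {σ} []      = verum , here refl , ⊨-verum {w = w} {σ}
  cells-cover {w} {σ} (φ ∷ Φ) with lem (w , σ ⊨ φ) | cells-cover {w} {σ} Φ
  ... | yes h | τ , τ∈ , h′ = (φ and τ) , ∈-++⁺ˡ (∈-map⁺ (φ and_) τ∈) , h , h′
  ... | no ¬h | τ , τ∈ , h′ = (neg φ and τ) , ∈-++⁺ʳ _ (∈-map⁺ (neg φ and_) τ∈) , ¬h , h′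

  other : Fin 2 → Fin 2
  other zero       = suc zero
  other (suc zero) = zero

  letters : Fin 2 → List (Formula n 2)
  letters x = map (λ a → P a x) (allFin n)

  earlier later : Fin 2 → Formula n 2 → Formula n 2
  earlier x τ = ex (other x) ((other x ≺ x) and τ)
  later   x τ = ex (other x) ((x ≺ other x) and τ)

  -- `types k x` lists the rank-`k` types of the position held by `x`. Each rank hands over to the
  -- other variable by requantifying it, which forgets its old value, so two names suffice at all
  -- ranks.
  parts types : ℕ → Fin 2 → List (Formula n 2)
  parts zero    x = letters x
  parts (suc k) x = letters x ++ map (earlier x) (types k (other x)) ++ map (later x) (types k (other x))
  types k x = cells (parts k x)

  sentences : ℕ → List (Formula n 2)
  sentences zero    = cells []
  sentences (suc k) = cells (map (ex zero) (types k zero))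

  letters∈ : ∀ k x {a} → P a x List.∈ parts k x
  letters∈ zero    x {a} = ∈-map⁺ (λ a → P a x) (∈-allFin a)
  letters∈ (suc k) x {a} = ∈-++⁺ˡ (∈-map⁺ (λ a → P a x) (∈-allFin a))

  lookup-other : ∀ {A : Set} (σ : Vec.Vec A 2) x j → Vec.lookup (σ [ other x ]≔ j) x ≡ Vec.lookup σ x
  lookup-other (_ ∷ _ ∷ []) zero       j = refl
  lookup-other (_ ∷ _ ∷ []) (suc zero) j = refl

  private
    at-most : ∀ {A : Set} {s : Maybe A} {i j} → s ≡ just i → s ≡ just j → i ≡ j
    at-most i≡ j≡ = just-injective (trans (sym i≡) j≡)

  types⇒letter≡ : ∀ {w w′ : Word n} k x {σ σ′ i i′ τ} →
                  Vec.lookup σ x ≡ just i → Vec.lookup σ′ x ≡ just i′ →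
                  τ List.∈ types k x → w , σ ⊨ τ → w′ , σ′ ⊨ τ → letter (at w i) ≡ letter (at w′ i′)
  types⇒letter≡ {w} {w′} k x {i = i} {i′} i≡ i′≡ τ∈ h h′
    with cells-agree (parts k x) τ∈ h h′ (letters∈ k x) (i , i≡ , refl)
  ... | _ , eq , l with at-most i′≡ eq
  ...   | refl = trans (letter-at w i) (trans (sym l) (sym (letter-at w′ i′)))

  types⇒∼ : ∀ {w w′ : Word n} k x {σ σ′ i i′ τ} →
            Vec.lookup σ x ≡ just i → Vec.lookup σ′ x ≡ just i′ →
            τ List.∈ types k x → w , σ ⊨ τ → w′ , σ′ ⊨ τ → at w i ∼[ k ] at w′ i′
  types⇒∼ zero    x i≡ i′≡ τ∈ h h′ = base (types⇒letter≡ 0 x i≡ i′≡ τ∈ h h′)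
  types⇒∼ {w} {w′} (suc k) x {τ = τ} i≡ i′≡ τ∈ h h′ =
    step (types⇒letter≡ (suc k) x i≡ i′≡ τ∈ h h′)
         (before i≡ i′≡ h h′ , before i′≡ i≡ h′ h) (after i≡ i′≡ h h′ , after i′≡ i≡ h′ h)
    where
    before : ∀ {w w′ σ σ′ i i′} → Vec.lookup σ x ≡ just i → Vec.lookup σ′ x ≡ just i′ →
             w , σ ⊨ τ → w′ , σ′ ⊨ τ → Forth _∼[ k ]_ (_⊰ at w i) (_⊰ at w′ i′)
    before {w} {w′} {σ} {σ′} {i} {i′} i≡ i′≡ h h′ =
      Forth-at {X = Fin._< i} {Fin._< i′} (λ {p} b → trans (word-at w i) (sym (⊰⇒word≡ p (at w i) b)))
        (λ j → ⊰⇒< w j i) (λ j → <⇒⊰ w′ j i′) respond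
      where
      respond : ∀ j → j Fin.< i → ∃[ j′ ] j′ Fin.< i′ × at w j ∼[ k ] at w′ j′
      -- The type of `j` has lower rank, and its occurrence before `i` is one of the parts on which
      -- both words agree by sharing `τ`.
      respond j j<i with cells-cover {w} {σ [ other x ]≔ just j} (parts k (other x))
      ... | υ , υ∈ , hυ
        with cells-agree (parts (suc k) x) τ∈ h h′
               (∈-++⁺ʳ (letters x) (∈-++⁺ˡ (∈-map⁺ (earlier x) υ∈)))
               (j , (j , i , lookup∘update (other x) σ _ , trans (lookup-other σ x _) i≡ , j<i) , hυ)
      ...   | j′ , (_ , _ , j≡ , eq , lt) , hυ′
        with at-most (lookup∘update (other x) σ′ _) j≡ | at-most (trans (lookup-other σ′ x _) i′≡) eq
      ...     | refl | refl =
        j′ , lt , types⇒∼ k (other x) (lookup∘update (other x) σ _) (lookup∘update (other x) σ′ _) υ∈ hυ hυ′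
    after : ∀ {w w′ σ σ′ i i′} → Vec.lookup σ x ≡ just i → Vec.lookup σ′ x ≡ just i′ →
            w , σ ⊨ τ → w′ , σ′ ⊨ τ → Forth _∼[ k ]_ (at w i ⊰_) (at w′ i′ ⊰_)
    after {w} {w′} {σ} {σ′} {i} {i′} i≡ i′≡ h h′ =
      Forth-at {X = i Fin.<_} {i′ Fin.<_} (λ {p} b → trans (word-at w i) (⊰⇒word≡ (at w i) p b))
        (λ j → ⊰⇒< w i j) (λ j → <⇒⊰ w′ i′ j) respond
      where
      respond : ∀ j → i Fin.< j → ∃[ j′ ] i′ Fin.< j′ × at w j ∼[ k ] at w′ j′
      respond j i<j with cells-cover {w} {σ [ other x ]≔ just j} (parts k (other x))
      ... | υ , υ∈ , hυ
        with cells-agree (parts (suc k) x) τ∈ h h′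
               (∈-++⁺ʳ (letters x) (∈-++⁺ʳ (map (earlier x) (types k (other x))) (∈-map⁺ (later x) υ∈)))
               (j , (i , j , trans (lookup-other σ x _) i≡ , lookup∘update (other x) σ _ , i<j) , hυ)
      ...   | j′ , (_ , _ , eq , j≡ , lt) , hυ′
        with at-most (lookup∘update (other x) σ′ _) j≡ | at-most (trans (lookup-other σ′ x _) i′≡) eq
      ...     | refl | refl =
        j′ , lt , types⇒∼ k (other x) (lookup∘update (other x) σ _) (lookup∘update (other x) σ′ _) υ∈ hυ hυ′

  sentences⇒≈ : ∀ {w w′ : Word n} k {τ} → τ List.∈ sentences k → w ⊨ τ → w′ ⊨ τ → w ≈[ k ] w′
  sentences⇒≈ zero    τ∈ h h′ = base
  sentences⇒≈ (suc k) {τ} τ∈ h h′ = step (F h h′ , F h′ h)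
    where
    F : ∀ {w w′} → w ⊨ τ → w′ ⊨ τ → Forth _∼[ k ]_ (λ p → w ≡ word p) (λ p → w′ ≡ word p)
    F {w} {w′} h h′ = Forth-at {X = λ _ → ⊤} {λ _ → ⊤} id _ (λ i _ → word-at w′ i) respond
      where
      respond : ∀ i → ⊤ → ∃[ i′ ] ⊤ × at w i ∼[ k ] at w′ i′
      respond i _ with cells-cover {w} {just i ∷ nothing ∷ []} (parts k zero)
      ... | υ , υ∈ , hυ
        with cells-agree (map (ex zero) (types k zero)) τ∈ h h′ (∈-map⁺ (ex zero) υ∈) (i , hυ)
      ...   | i′ , hυ′ = i′ , tt , types⇒∼ k zero {just i ∷ nothing ∷ []} {just i′ ∷ nothing ∷ []}
                                               refl refl υ∈ hυ hυ′

  sentences-cover : ∀ k w → Any (w ⊨_) (sentences k)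
  sentences-cover zero    w =
    let τ , τ∈ , h = cells-cover {w} {Vec.replicate 2 nothing} [] in List.lose τ∈ h
  sentences-cover (suc k) w =
    let τ , τ∈ , h = cells-cover {w} {Vec.replicate 2 nothing} (map (ex zero) (types k zero)) in List.lose τ∈ h

  other∉ : ∀ k x → All (other x ∉free_) (types k x)
  other∉ k x = cells-∉free (parts k x) (parts∉ k x)
    where
    other≢ : ∀ x → other x ≢ x
    other≢ zero       ()
    other≢ (suc zero) ()
    letters∉ : ∀ x → All (other x ∉free_) (letters x)
    letters∉ x = All.map⁺ {f = λ a → P a x} (All.tabulate λ _ → Sub.x≢y⇒x∉⁅y⁆ (other≢ x))
    self : ∀ x τ → other x ∉free (ex (other x) τ)
    self x τ = x∉p-x (freeVars τ) (other x)
    parts∉ : ∀ k x → All (other x ∉free_) (parts k x)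
    parts∉ zero    x = letters∉ x
    parts∉ (suc k) x = All.++⁺ (letters∉ x) (All.++⁺
      (All.map⁺ {xs = types k (other x)} {f = earlier x} (All.tabulate λ {τ} _ → self x ((other x ≺ x) and τ)))
      (All.map⁺ {xs = types k (other x)} {f = later x} (All.tabulate λ {τ} _ → self x ((x ≺ other x) and τ))))

  sentences-closed : ∀ k → All Sentence (sentences k)
  sentences-closed k = All.map (λ {φ} → close {φ}) (All.zip (∉ k zero , ∉ k (suc zero)))
    where
    ∉ : ∀ k x → All (x ∉free_) (sentences k)
    ∉ zero    x = cells-∉free [] []
    ∉ (suc k) zero = cells-∉free (map (ex zero) (types k zero))
      (All.map⁺ {xs = types k zero} {f = ex zero} (All.tabulate λ {τ} _ → x∉p-x (freeVars τ) zero))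
    ∉ (suc k) (suc zero) = cells-∉free (map (ex zero) (types k zero))
      (All.map⁺ {xs = types k zero} {f = ex zero}
        (All.map (λ {τ} h → h ∘ Sub.p─q⊆p (freeVars τ) Sub.⁅ zero ⁆) (other∉ k zero)))
    close : ∀ {φ : Formula n 2} → zero ∉free φ × suc zero ∉free φ → Sentence φ
    close (h , _) (zero     , x∈) = h x∈
    close (_ , h) (suc zero , x∈) = h x∈

-- Alphabets and classes

alph⁻ : ∀ (u : Word n) {c} → c Sub.∈ alph u → ∃[ p ] u ≡ word p × letter p ≡ c
alph⁻ []      c∈ = ⊥-elim (Sub.∉⊥ c∈)
alph⁻ (a ∷ u) c∈ with Sub.x∈p∪q⁻ Sub.⁅ a ⁆ (alph u) c∈
... | inj₁ c∈a = [] ◁ a ▷ u , refl , sym (Sub.x∈⁅y⁆⇒x≡y a c∈a)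
... | inj₂ c∈u with alph⁻ u c∈u
...   | p , refl , eq = [ a ] ◃ p , refl , eq

alph-++ : ∀ (u v : Word n) → alph (u ++ v) ≡ alph u Sub.∪ alph v
alph-++ []      v = sym (Sub.∪-identityˡ _)
alph-++ (a ∷ u) v =
  trans (cong (Sub.⁅ a ⁆ Sub.∪_) (alph-++ u v)) (sym (Sub.∪-assoc _ (alph u) (alph v)))

*-alph : ∀ (u : Word n) → (alph u *) u
*-alph []      = []
*-alph (a ∷ u) = Sub.p⊆p∪q (alph u) (Sub.x∈⁅x⁆ a) ∷ All.map (Sub.q⊆p∪q Sub.⁅ a ⁆ (alph u)) (*-alph u)

alph-least : ∀ {B : Subset n} (u : Word n) → (B *) u → alph u Sub.⊆ B
alph-least {B = B} u u∈ c∈ with alph⁻ u c∈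
... | p , refl , refl = All-letter p u∈

≈⇒alph⊆ : u ≈[ suc k ] v → alph v Sub.⊆ alph u
≈⇒alph⊆ {u = u} {v = v} e = alph-least v (≈⇒All e (*-alph u))

≈⇒alph≡ : u ≈[ suc k ] v → alph u ≡ alph v
≈⇒alph≡ e = Sub.⊆-antisym (≈⇒alph⊆ (≈-sym e)) (≈⇒alph⊆ e)

alph⇒Full : ∀ (u : Word n) → Pumping.Full (alph u) u
alph⇒Full u = *-alph u , alph⁻ u

∌⇒* : ∀ {B : Subset n} {b u} → (B *) u → u ∌ b → ((B Sub.- b) *) u
∌⇒* u∈ u∌ = All.zipWith (λ (c∈ , c≢) → Sub.x∈p∧x≢y⇒x∈p-y c∈ c≢) (u∈ , u∌)

≈class : ℕ → Word n → Language n
≈class k w = w ≈[ k ]_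

≈class⊆-first : ∀ {b : Fin n} {u v k₁ k₂} → k₁ ℕ.≤ k → k₂ ℕ.≤ k → u ∌ b →
             ≈class (3 ℕ.+ k) (u ++ b ∷ v) ⊆ (≈class k₁ u · ｛ [ b ] ｝) · ≈class k₂ v
≈class⊆-first {b = b} k₁≤ k₂≤ u∌ e with splits-at-first _ u∌ e
... | u′ , v′ , refl , _ , eᵘ , eᵛ =
  u′ ++ [ b ] , v′ , (u′ , [ b ] , ≈-mono k₁≤ eᵘ , refl , refl) , ≈-mono k₂≤ eᵛ ,
  sym (++-assoc u′ [ b ] v′)

≈class⊆-last : ∀ {b : Fin n} {u v k₁ k₂} → k₁ ℕ.≤ k → k₂ ℕ.≤ k → v ∌ b →
            ≈class (3 ℕ.+ k) (u ++ b ∷ v) ⊆ ≈class k₂ u · (｛ [ b ] ｝ · ≈class k₁ v)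
≈class⊆-last {b = b} k₁≤ k₂≤ v∌ e with splits-at-last _ v∌ e
... | u′ , v′ , refl , _ , eᵘ , eᵛ =
  u′ , b ∷ v′ , ≈-mono k₂≤ eᵘ , ([ b ] , v′ , refl , ≈-mono k₁≤ eᵛ , refl) , refl

∪-⊆ : ∀ {B C D : Subset n} → C Sub.⊆ B → D Sub.⊆ B → C Sub.∪ D Sub.⊆ B
∪-⊆ {C = C} {D} C⊆ D⊆ x∈ = [ C⊆ , D⊆ ]′ (Sub.x∈p∪q⁻ C D x∈)

uniform-bound : ∀ {m} (Q : Fin m → ℕ → Set) → (∀ {i k l} → k ℕ.≤ l → Q i k → Q i l) →
                (∀ i → ∃[ k ] Q i k) → ∃[ k ] ∀ i → Q i k
uniform-bound {zero}  Q mono f = 0 , λ ()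
uniform-bound {suc m} Q mono f with f zero | uniform-bound (Q ∘ suc) mono (f ∘ suc)
... | k , q | l , h = k ℕ.⊔ l , λ where
  zero    → mono (m≤m⊔n k l) q
  (suc i) → mono (m≤n⊔m k l) (h i)

strict-wellFounded : ∀ {m} {R : Fin m → Fin m → Set} → (∀ i → R i i) →
                     (∀ {i j l} → R i j → R j l → R i l) →
                     WellFounded (λ i j → R j i × ¬ R i j)
strict-wellFounded {R = R} rfl tr = spo-wellFounded {_≈_ = _≡_} record
  { isEquivalence = ≡.isEquivalence
  ; irrefl        = λ { refl (_ , ¬r) → ¬r (rfl _) }
  ; trans         = λ (r , ¬r) (r′ , ¬r′) → tr r′ r , λ h → ¬r (tr h r′)
  ; <-resp-≈      = (λ { refl h → h }) , λ { refl h → h }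
  }

-- Rating maps

module Proof {c ℓ : Level} {n : ℕ} (R : IdempotentSemiring c ℓ) (finite : FiniteSemiring R)
             (ratingMap : RatingMap R n) (compat : AlphabetCompatible ratingMap) where

  module R = IdempotentSemiring R
  open R using (Carrier; _≈_; _+_; 1#) renaming (_*_ to _⊙_)
  open RatingMap ratingMap
  module ρ = SemiringMorphisms.IsSemiringHomomorphism isHomomorphism
  open AlphabetCompatible compat
  module α = MonoidMorphisms.IsMonoidHomomorphism isMorphism
  open SetoidReasoning R.setoid

  m : ℕ
  m = proj₁ finite

  open Inverse (proj₂ finite) using (to; from; to-cong; from-cong; strictlyInverseˡ; strictlyInverseʳ)

  infix 4 _⊑_
  _⊑_ : Carrier → Carrier → Set ℓ
  _⊑_ = _≤_ ratingMap

  from-to : ∀ r → from (to r) ≈ r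
  from-to = strictlyInverseʳ

  to-injective : ∀ {r t} → to r ≡ to t → r ≈ t
  to-injective {r} {t} eq = R.trans (R.sym (from-to r)) (R.trans (from-cong eq) (from-to t))

  infix 4 _≈?_
  _≈?_ : ∀ r t → Dec (r ≈ t)
  r ≈? t = map′ to-injective to-cong (to r ≟ to t)

  excluded-middle : (X : Set) → Dec X
  excluded-middle X with ρ (λ w → [] ≡ w × X) ≈? ρ ｛ [] ｝
  ... | yes eq =
    let _ , (_ , x) , _ = proj₁ (compatible _) (proj₂ (α.⟦⟧-cong eq) (proj₂ (compatible _) ([] , refl , refl)))
    in yes x
  ... | no ¬eq = no λ x → ¬eq (ρ.⟦⟧-cong (proj₁ , _, x))

  ⊑-trans : ∀ {r t s} → r ⊑ t → t ⊑ s → r ⊑ s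
  ⊑-trans {r} {t} {s} h h′ = begin
    r + s       ≈⟨ R.+-congˡ h′ ⟨
    r + (t + s) ≈⟨ R.+-assoc r t s ⟨
    r + t + s   ≈⟨ R.+-congʳ h ⟩
    t + s       ≈⟨ h′ ⟩
    s           ∎

  ≈⇒⊑ : ∀ {r t} → r ≈ t → r ⊑ t
  ≈⇒⊑ {r} {t} h = R.trans (R.+-congʳ h) (R.+-idem t)

  ⊙-mono : ∀ {r r′ t t′} → r ⊑ r′ → t ⊑ t′ → r ⊙ t ⊑ r′ ⊙ t′
  ⊙-mono {r} {r′} {t} {t′} h h′ =
    ⊑-trans {t = r′ ⊙ t} (R.trans (R.sym (R.distribʳ t r r′)) (R.*-congʳ h))
                         (R.trans (R.sym (R.distribˡ r′ t t′)) (R.*-congˡ h′))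

  ρ-mono : ∀ {K L : Language n} → K ⊆ L → ρ K ⊑ ρ L
  ρ-mono {K} {L} K⊆L = R.trans (R.sym (ρ.+-homo K L)) (ρ.⟦⟧-cong ([ K⊆L , id ]′ , inj₂))

  ρ-≈class-· : ∀ k u v → ρ (≈class k u) ⊙ ρ (≈class k v) ⊑ ρ (≈class k (u ++ v))
  ρ-≈class-· k u v = ⊑-trans (≈⇒⊑ (R.sym (ρ.*-homo _ _)))
    (ρ-mono λ { (_ , _ , e , f , refl) → ≈-cong k e f })

  Saturated : ∀ {s} → Pred Carrier s → Set _
  Saturated = FO²-Saturated compat

  -- Soundness: the imprint of the classes is saturated

  classImprint : ℕ → Pred Carrier ℓ
  classImprint k r = ∃[ w ] r ⊑ ρ (≈class k w)

  -- `alphᴿ` is additive, hence monotone, so B is the alphabet of some word of the class. The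
  -- representative has to change because a class for 0 rounds mixes alphabets.
  alph-representative : ∀ {k r B} → r ∈ classImprint k → alphᴿ r ≐ ｛ B ｝ →
                        ∃[ u ] alph u ≡ B × r ⊑ ρ (≈class k u)
  alph-representative {k} {r} (w , r⊑) r-alph with
    proj₁ (compatible (≈class k w)) (proj₁ (α.⟦⟧-cong r⊑) (proj₂ (α.homo r _) (inj₁ (proj₂ r-alph refl))))
  ... | u , w≈u , u-alph = u , u-alph , ⊑-trans r⊑ (ρ-mono (≈-trans (≈-sym w≈u)))

  -- The exponent is one more than the index: an idempotent below the class of `u` stays below those
  -- of the positive powers of `u`, not necessarily below that of the empty word.
  powerˡ powerʳ : Word n → ℕ → Word n
  powerˡ u zero    = u
  powerˡ u (suc k) = powerˡ u k ++ u
  powerʳ u zero    = u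
  powerʳ u (suc k) = u ++ powerʳ u k

  module _ {B : Subset n} where
    open Pumping B

    powerˡ-Blocks : ∀ {u} k → Full u → Blocksˡ k (powerˡ u k)
    powerˡ-Blocks zero    full = none
    powerˡ-Blocks (suc k) full = more (powerˡ-Blocks k full) full

    powerʳ-Blocks : ∀ {u} k → Full u → Blocksʳ k (powerʳ u k)
    powerʳ-Blocks zero    full = none
    powerʳ-Blocks (suc k) full = more full (powerʳ-Blocks k full)

  module _ {e : Carrier} (idem : e ⊙ e ≈ e) {k u} (e⊑ : e ⊑ ρ (≈class k u)) where

    idempotent⊑powerˡ : ∀ j → e ⊑ ρ (≈class k (powerˡ u j))
    idempotent⊑powerˡ zero    = e⊑
    idempotent⊑powerˡ (suc j) = ⊑-trans (≈⇒⊑ (R.sym idem))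
      (⊑-trans (⊙-mono (idempotent⊑powerˡ j) e⊑) (ρ-≈class-· k (powerˡ u j) u))

    idempotent⊑powerʳ : ∀ j → e ⊑ ρ (≈class k (powerʳ u j))
    idempotent⊑powerʳ zero    = e⊑
    idempotent⊑powerʳ (suc j) = ⊑-trans (≈⇒⊑ (R.sym idem))
      (⊑-trans (⊙-mono e⊑ (idempotent⊑powerʳ j)) (ρ-≈class-· k u (powerʳ u j)))

  classImprint-saturated : ∀ k → Saturated (classImprint k)
  classImprint-saturated k = record
    { trivial   = λ (w , h) → w , ⊑-trans h (ρ-mono λ { refl → ≈-refl k w })
    ; downward  = λ (w , h) h′ → w , ⊑-trans h′ h
    ; multiply  = λ (u , h) (v , h′) → u ++ v , ⊑-trans (⊙-mono h h′) (ρ-≈class-· k u v)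
    ; operation = operation
    }
    where
    operation : ∀ B {e f} → e ∈ classImprint k → f ∈ classImprint k → e ⊙ e ≈ e → f ⊙ f ≈ f →
                alphᴿ e ≐ ｛ B ｝ → alphᴿ f ≐ ｛ B ｝ → e ⊙ ρ (B *) ⊙ f ∈ classImprint k
    operation B e∈ f∈ ee ff e-alph f-alph
      with alph-representative e∈ e-alph | alph-representative f∈ f-alph
    -- Since `ρ (B *)` gathers all `x` at once, a single class must contain every product of words
    -- around every `x`; pumping with an empty middle makes `U ++ V` its representative.
    ... | u , refl , e⊑ | v , v-alph , f⊑ = U ++ V , ⊑-trans
      (⊙-mono (⊙-mono (idempotent⊑powerˡ ee e⊑ k) (≈⇒⊑ R.refl)) (idempotent⊑powerʳ ff f⊑ k))
      (⊑-trans (≈⇒⊑ (R.sym (R.trans (ρ.*-homo _ _) (R.*-congʳ (ρ.*-homo _ _)))))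
        (ρ-mono λ { (_ , v′ , (u′ , x , u≈ , x∈ , refl) , v≈ , refl) →
          subst (U ++ V ≈[ k ]_) (sym (++-assoc u′ x v′))
            (≈-trans (Pumping.pumping B k (powerˡ-Blocks k (alph⇒Full u))
                       (powerʳ-Blocks k (subst (λ B → Pumping.Full B v) v-alph (alph⇒Full v))) [] x∈)
              (≈-cong k u≈ (≈-cong k (≈-refl k x) v≈))) }))
      where
      U = powerˡ u k
      V = powerʳ v k

  -- The least saturated set lives on the codes Fin m, so that it is small enough for
  -- excluded-middle whatever the levels of R.
  data Least : Fin m → Set where
    trivialᶜ   : ∀ {i} w → to (from i + ρʷ w) ≡ to (ρʷ w) → Least i
    downwardᶜ  : ∀ {i j} → Least i → to (from j + from i) ≡ i → Least j
    multiplyᶜ  : ∀ {i j} → Least i → Least j → Least (to (from i ⊙ from j))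
    operationᶜ : ∀ B {i j} → Least i → Least j → to (from i ⊙ from i) ≡ i → to (from j ⊙ from j) ≡ j →
                alphᴿ (from i) ≐ ｛ B ｝ → alphᴿ (from j) ≐ ｛ B ｝ → Least (to (from i ⊙ ρ (B *) ⊙ from j))

  least : Pred Carrier 0ℓ
  least r = Least (to r)

  to⁻ : ∀ {r i} → to r ≡ i → r ≈ from i
  to⁻ {r} eq = R.trans (R.sym (from-to r)) (from-cong eq)

  least-saturated : Saturated least
  least-saturated = record
    { trivial   = λ {r} (w , h) → trivialᶜ w (to-cong (R.trans (R.+-congʳ (from-to r)) h))
    ; downward  = λ {r} {r′} l h → downwardᶜ l (to-cong (R.trans (R.+-cong (from-to r′) (from-to r)) h))
    ; multiply  = λ {t} {u} l l′ →
        subst Least (to-cong (R.*-cong (from-to t) (from-to u))) (multiplyᶜ l l′)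
    ; operation = λ B {e} {f} l l′ ee ff e-alph f-alph →
        subst Least (to-cong (R.*-cong (R.*-congʳ (from-to e)) (from-to f)))
          (operationᶜ B l l′ (to-cong (idem e ee)) (to-cong (idem f ff)) (code e-alph) (code f-alph))
    }
    where
    idem : ∀ e → e ⊙ e ≈ e → from (to e) ⊙ from (to e) ≈ e
    idem e h = R.trans (R.*-cong (from-to e) (from-to e)) h
    code : ∀ {e B} → alphᴿ e ≐ ｛ B ｝ → alphᴿ (from (to e)) ≐ ｛ B ｝
    code {e} (h , h′) = h ∘ proj₁ (α.⟦⟧-cong (from-to e)) , proj₂ (α.⟦⟧-cong (from-to e)) ∘ h′

  least⊆ : ∀ {s} {S : Pred Carrier s} → Saturated S → least ⊆ S
  least⊆ {S = S} sat {r} l = S.downward (decode l) (≈⇒⊑ (R.sym (from-to r)))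
    where
    module S = FO²-Saturated sat
    decode : ∀ {i} → Least i → from i ∈ S
    decode (trivialᶜ w h)   = S.trivial (w , to-injective h)
    decode (downwardᶜ l h)  = S.downward (decode l) (to⁻ h)
    decode (multiplyᶜ l l′) = S.downward (S.multiply (decode l) (decode l′)) (≈⇒⊑ (from-to _))
    decode (operationᶜ B l l′ ee ff e-alph f-alph) =
      S.downward (S.operation B (decode l) (decode l′) (to⁻ ee) (to⁻ ff) e-alph f-alph) (≈⇒⊑ (from-to _))

  -- Idempotent powers in a finite semiring

  open Exp R.semiring using (_^_; ^-homo-*)

  -- By the pigeonhole principle the powers of `r` are periodic from exponent `a` on, with period
  -- `suc d`. The exponent `N` is a multiple of the period and at least `a`, so doubling it changes
  -- nothing; `suc` of the witness computes to `N`.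
  idempotent-power : ∀ r → ∃[ k ] r ^ suc k ⊙ r ^ suc k ≈ r ^ suc k
  idempotent-power r with pigeonhole (ℕ.n<1+n m) (λ (k : Fin (suc m)) → to (r ^ suc (toℕ k)))
  ... | i , j , i<j , eq = toℕ i ℕ.+ d ℕ.* suc (toℕ i) , (begin
    r ^ N ⊙ r ^ N                                      ≈⟨ ^-homo-* r N N ⟨
    r ^ (N ℕ.+ N)                                      ≡⟨ cong (λ z → r ^ (N ℕ.+ z)) (ℕ.*-comm (suc d) a) ⟩
    r ^ (N ℕ.+ a ℕ.* suc d)                            ≈⟨ periodic a (d ℕ.* a) ⟩
    r ^ N                                              ∎)
    where
    a d N : ℕ
    a = suc (toℕ i)
    d = toℕ j ℕ.∸ a
    N = suc d ℕ.* a
    j≡ : suc (toℕ j) ≡ a ℕ.+ suc d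
    j≡ = trans (cong suc (sym (ℕ.m+[n∸m]≡n i<j))) (sym (ℕ.+-suc a d))
    periodic : ∀ k x → r ^ ((a ℕ.+ x) ℕ.+ k ℕ.* suc d) ≈ r ^ (a ℕ.+ x)
    periodic zero    x = R.reflexive (cong (r ^_) (ℕ.+-identityʳ (a ℕ.+ x)))
    periodic (suc k) x = begin
      r ^ ((a ℕ.+ x) ℕ.+ (suc d ℕ.+ k ℕ.* suc d)) ≡⟨ cong (r ^_) (shuffle a x (suc d) (k ℕ.* suc d)) ⟩
      r ^ ((a ℕ.+ suc d) ℕ.+ (x ℕ.+ k ℕ.* suc d)) ≈⟨ ^-homo-* r (a ℕ.+ suc d) _ ⟩
      r ^ (a ℕ.+ suc d) ⊙ r ^ (x ℕ.+ k ℕ.* suc d) ≡⟨ cong (λ z → r ^ z ⊙ r ^ (x ℕ.+ k ℕ.* suc d)) (sym j≡) ⟩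
      r ^ suc (toℕ j) ⊙ r ^ (x ℕ.+ k ℕ.* suc d)   ≈⟨ R.*-congʳ (to-injective eq) ⟨
      r ^ a ⊙ r ^ (x ℕ.+ k ℕ.* suc d)             ≈⟨ ^-homo-* r a _ ⟨
      r ^ (a ℕ.+ (x ℕ.+ k ℕ.* suc d))             ≡⟨ cong (r ^_) (ℕ.+-assoc a x _) ⟨
      r ^ ((a ℕ.+ x) ℕ.+ k ℕ.* suc d)             ≈⟨ periodic k x ⟩
      r ^ (a ℕ.+ x)                               ∎
      where
      shuffle : ∀ a x d y → (a ℕ.+ x) ℕ.+ (d ℕ.+ y) ≡ (a ℕ.+ d) ℕ.+ (x ℕ.+ y)
      shuffle = solve-∀

  -- Completeness: some finite rank has all class values in a saturated set

  module Completeness {S : Pred Carrier 0ℓ} (saturated : Saturated S) where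

    open FO²-Saturated saturated

    S-resp-≈ : ∀ {r t} → r ≈ t → r ∈ S → t ∈ S
    S-resp-≈ h r∈ = downward r∈ (≈⇒⊑ (R.sym h))

    -- Nothing forces alphᴿ to be multiplicative outside the image of ρ, so products are only
    -- taken of values of languages whose words all have the same alphabet.
    data Pure : Subset n → Fin m → Set where
      single : ∀ w → Pure (alph w) (to (ρʷ w))
      class  : ∀ k w → ρ (≈class (suc k) w) ∈ S → Pure (alph w) (to (ρ (≈class (suc k) w)))
      _∙_    : ∀ {C D i j} → Pure C i → Pure D j → Pure (C Sub.∪ D) (to (from i ⊙ from j))

    Pure⇒language : ∀ {C i} → Pure C i →
                    ∃[ K ] from i ≈ ρ K × (∃[ w ] w ∈ K) × (∀ {w} → w ∈ K → alph w ≡ C)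
    Pure⇒language (single w)    = ｛ w ｝ , from-to _ , (w , refl) , λ { refl → refl }
    Pure⇒language (class k w _) =
      ≈class (suc k) w , from-to _ , (w , ≈-refl _ w) , λ e → sym (≈⇒alph≡ e)
    Pure⇒language (p ∙ q) with Pure⇒language p | Pure⇒language q
    ... | K , i≈ , (u , u∈) , K-alph | L , j≈ , (v , v∈) , L-alph =
      (K · L) , R.trans (from-to _) (R.trans (R.*-cong i≈ j≈) (R.sym (ρ.*-homo K L))) ,
      (u ++ v , u , v , u∈ , v∈ , refl) ,
      λ { (u , v , u∈ , v∈ , refl) → trans (alph-++ u v) (cong₂ Sub._∪_ (K-alph u∈) (L-alph v∈)) }

    Pure⇒alph : ∀ {C i} → Pure C i → alphᴿ (from i) ≐ ｛ C ｝
    Pure⇒alph p with Pure⇒language p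
    ... | K , i≈ , (w , w∈) , K-alph =
      (λ h → let v , v∈ , eq = proj₁ (compatible K) (proj₁ (α.⟦⟧-cong i≈) h) in
             trans (sym (K-alph v∈)) eq) ,
      λ { refl → proj₂ (α.⟦⟧-cong i≈) (proj₂ (compatible K) (w , w∈ , K-alph w∈)) }

    ρʷ∈S : ∀ w → ρʷ w ∈ S
    ρʷ∈S w = trivial (w , ≈⇒⊑ R.refl)

    1∈S : 1# ∈ S
    1∈S = S-resp-≈ ρ.1#-homo (ρʷ∈S [])

    Pure⇒∈ : ∀ {C i} → Pure C i → from i ∈ S
    Pure⇒∈ (single w)    = S-resp-≈ (R.sym (from-to _)) (ρʷ∈S w)
    Pure⇒∈ (class _ _ h) = S-resp-≈ (R.sym (from-to _)) h
    Pure⇒∈ (p ∙ q)       = S-resp-≈ (R.sym (from-to _)) (multiply (Pure⇒∈ p) (Pure⇒∈ q))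

    infix 4 _⇝ʳ⟨_⟩_ _⇝ˡ⟨_⟩_
    -- Green's R- and L-preorders, restricted to pure multipliers with alphabet inside B, so that a
    -- return path has a known alphabet and lies in S.
    _⇝ʳ⟨_⟩_ _⇝ˡ⟨_⟩_ : Fin m → Subset n → Fin m → Set
    i ⇝ʳ⟨ B ⟩ j = ∃₂ λ C q → C Sub.⊆ B × Pure C q × to (from i ⊙ from q) ≡ j
    i ⇝ˡ⟨ B ⟩ j = ∃₂ λ C q → C Sub.⊆ B × Pure C q × to (from q ⊙ from i) ≡ j

    one : Fin m
    one = to (ρʷ [])

    from-one : from one ≈ 1#
    from-one = R.trans (from-to _) ρ.1#-homo

    to-from : ∀ {r i} → r ≈ from i → to r ≡ i
    to-from {i = i} h = trans (to-cong h) (strictlyInverseˡ i)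

    ⇝ʳ-refl : ∀ {B} i → i ⇝ʳ⟨ B ⟩ i
    ⇝ʳ-refl i = alph [] , one , Sub.⊥⊆ , single [] ,
      to-from (R.trans (R.*-congˡ from-one) (R.*-identityʳ _))

    ⇝ˡ-refl : ∀ {B} i → i ⇝ˡ⟨ B ⟩ i
    ⇝ˡ-refl i = alph [] , one , Sub.⊥⊆ , single [] ,
      to-from (R.trans (R.*-congʳ from-one) (R.*-identityˡ _))

    ⇝ʳ-trans : ∀ {B i j l} → i ⇝ʳ⟨ B ⟩ j → j ⇝ʳ⟨ B ⟩ l → i ⇝ʳ⟨ B ⟩ l
    ⇝ʳ-trans {i = i} (C , q , C⊆ , p , refl) (D , q′ , D⊆ , p′ , refl) =
      C Sub.∪ D , _ , ∪-⊆ C⊆ D⊆ , p ∙ p′ , to-cong (begin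
        from i ⊙ from (to (from q ⊙ from q′)) ≈⟨ R.*-congˡ (from-to _) ⟩
        from i ⊙ (from q ⊙ from q′)           ≈⟨ R.*-assoc _ _ _ ⟨
        from i ⊙ from q ⊙ from q′             ≈⟨ R.*-congʳ (from-to _) ⟨
        from (to (from i ⊙ from q)) ⊙ from q′ ∎)

    ⇝ˡ-trans : ∀ {B i j l} → i ⇝ˡ⟨ B ⟩ j → j ⇝ˡ⟨ B ⟩ l → i ⇝ˡ⟨ B ⟩ l
    ⇝ˡ-trans {i = i} (C , q , C⊆ , p , refl) (D , q′ , D⊆ , p′ , refl) =
      D Sub.∪ C , _ , ∪-⊆ D⊆ C⊆ , p′ ∙ p , to-cong (begin
        from (to (from q′ ⊙ from q)) ⊙ from i ≈⟨ R.*-congʳ (from-to _) ⟩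
        from q′ ⊙ from q ⊙ from i             ≈⟨ R.*-assoc _ _ _ ⟩
        from q′ ⊙ (from q ⊙ from i)           ≈⟨ R.*-congˡ (from-to _) ⟨
        from q′ ⊙ from (to (from q ⊙ from i)) ∎)

    module _ {ℓ′} (X : Fin m → Set ℓ′) (X-one : X one)
             (X-· : ∀ {i j} → X i → X j → X (to (from i ⊙ from j))) where

      -- X will be the set of stabilisers of a context. Each factor contains its own letter and
      -- stays inside B, so the product over all letters of B has alphabet exactly B; the empty
      -- product `one` covers empty B.
      gather : ∀ {B} → (∀ {b} → b Sub.∈ B → ∃₂ λ C q → b Sub.∈ C × C Sub.⊆ B × Pure C q × X q) →
               ∃[ q ] Pure B q × X q
      gather {B} f with go (allFin n)
        where
        go : ∀ bs → ∃₂ λ C q → C Sub.⊆ B × (∀ {b} → b List.∈ bs → b Sub.∈ B → b Sub.∈ C) × Pure C q × X q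
        go []       = alph [] , one , Sub.⊥⊆ , (λ ()) , single [] , X-one
        go (b ∷ bs) with go bs | b Sub.∈? B
        ... | C , q , C⊆ , h , p , x | no b∉ =
          C , q , C⊆ , (λ { (here refl) b∈ → ⊥-elim (b∉ b∈) ; (there b∈) → h b∈ }) , p , x
        ... | C , q , C⊆ , h , p , x | yes b∈ =
          let D , q′ , b∈D , D⊆ , p′ , x′ = f b∈ in
          D Sub.∪ C , _ , ∪-⊆ D⊆ C⊆ ,
          (λ { (here refl) _ → Sub.p⊆p∪q C b∈D ; (there c∈) c∈B → Sub.q⊆p∪q D C (h c∈ c∈B) }) ,
          p′ ∙ p , X-· x′ x
      ... | C , q , C⊆ , h , p , x =
        q , subst (λ C → Pure C q) (Sub.⊆-antisym C⊆ (h (∈-allFin _))) p , x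

      power : ∀ {B q} → Pure B q → X q → ∀ k → ∃[ q′ ] Pure B q′ × X q′ × from q′ ≈ from q ^ suc k
      power {q = q} p x zero    = q , p , x , R.sym (R.*-identityʳ _)
      power {q = q} p x (suc k) = let q′ , p′ , x′ , eq = power p x k in
        _ , subst (λ C → Pure C (to (from q ⊙ from q′))) (Sub.∪-idem _) (p ∙ p′) , X-· x x′ ,
        R.trans (from-to _) (R.*-congˡ eq)

      pure-idempotent : ∀ {B} → (∀ {b} → b Sub.∈ B → ∃₂ λ C q → b Sub.∈ C × C Sub.⊆ B × Pure C q × X q) →
                        ∃[ e ] Pure B e × X e × from e ⊙ from e ≈ from e
      pure-idempotent {B} f = let q , p , x = gather f in idempotent p x (idempotent-power (from q))
        where
        idempotent : ∀ {q} → Pure B q → X q → ∃[ k ] from q ^ suc k ⊙ from q ^ suc k ≈ from q ^ suc k →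
                     ∃[ e ] Pure B e × X e × from e ⊙ from e ≈ from e
        idempotent p x (k , idem) = let e , p′ , x′ , e≈ = power p x k in
          e , p′ , x′ , R.trans (R.*-cong e≈ e≈) (R.trans idem (R.sym e≈))

    Covered : Subset n → Carrier → Carrier → ℕ → Set
    Covered B r t k = ∀ w → (B *) w → r ⊙ ρ (≈class k w) ⊙ t ∈ S

    Covered-mono : ∀ {B r t k l} → k ℕ.≤ l → Covered B r t k → Covered B r t l
    Covered-mono k≤l h w w∈ =
      downward (h w w∈) (⊙-mono (⊙-mono (≈⇒⊑ R.refl) (ρ-mono (≈-mono k≤l))) (≈⇒⊑ R.refl))

    infix 4 _⊏ʳ⟨_⟩_ _⊏ˡ⟨_⟩_
    _⊏ʳ⟨_⟩_ _⊏ˡ⟨_⟩_ : Fin m → Subset n → Fin m → Set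
    i ⊏ʳ⟨ B ⟩ j = j ⇝ʳ⟨ B ⟩ i × ¬ i ⇝ʳ⟨ B ⟩ j
    i ⊏ˡ⟨ B ⟩ j = j ⇝ˡ⟨ B ⟩ i × ¬ i ⇝ˡ⟨ B ⟩ j

    -- A bound exists only for the codes in V and W; all others receive 0. Telling them apart takes
    -- `excluded-middle`, which applies to the strict orders because S, and with it `Pure`, takes
    -- values in `Set`.
    uniformly : ∀ {V W : Fin m → Set} {Q : Fin m → ℕ → Set} → (∀ {i k l} → k ℕ.≤ l → Q i k → Q i l) →
                (∀ {i} → V i → W i → ∃[ k ] Q i k) → ∃[ k ] ∀ {i} → V i → W i → Q i k
    uniformly {V} {W} {Q} mono f =
      let k , h = uniform-bound (λ i k → V i × W i → Q i k) (λ k≤l h vw → mono k≤l (h vw)) bound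
      in k , λ v w → h _ (v , w)
      where
      bound : ∀ i → ∃[ k ] (V i × W i → Q i k)
      bound i with excluded-middle (V i × W i)
      ... | yes (v , w) = let k , q = f v w in k , λ _ → q
      ... | no ¬vw      = 0 , λ vw → ⊥-elim (¬vw vw)

    -- The induction step: cut at a letter, or stabilise both contexts

    module Step (B : Subset n) (i j : Fin m) (i∈ : from i ∈ S) (j∈ : from j ∈ S)
      (smaller : ∀ {b} → b Sub.∈ B → ∀ {i j} → from i ∈ S → from j ∈ S →
                 ∃[ k ] Covered (B Sub.- b) (from i) (from j) k)
      (lowerʳ : ∀ {i′} → i′ ⊏ʳ⟨ B ⟩ i → from i′ ∈ S → ∃[ k ] Covered B (from i′) (from j) k)
      (lowerˡ : ∀ {j′} → j′ ⊏ˡ⟨ B ⟩ j → from j′ ∈ S → ∃[ k ] Covered B (from i) (from j′) k)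
      where

      one∈ : from one ∈ S
      one∈ = S-resp-≈ (R.sym from-one) 1∈S

      -- The induction hypothesis for the smaller alphabet with trivial contexts. The extra round
      -- gives all words of a class the same alphabet, as `Pure` demands.
      classes : ∀ {b} → b Sub.∈ B → ∃[ k ] ∀ u → ((B Sub.- b) *) u → ρ (≈class (suc k) u) ∈ S
      classes b∈ = let k , h = smaller b∈ one∈ one∈ in k , λ u u∈ → downward (h u u∈)
        (⊑-trans (ρ-mono (≈-mono (n≤1+n k))) (≈⇒⊑ (R.sym
          (R.trans (R.*-cong (R.trans (R.*-congʳ from-one) (R.*-identityˡ _)) from-one) (R.*-identityʳ _)))))

      -- Existential in `u`: one return suffices to build a stabiliser containing `b`, whereas a cut
      -- meets an arbitrary prefix or suffix and needs that none returns.
      Returnsʳ Returnsˡ : ∀ {b} → b Sub.∈ B → Set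
      Returnsʳ {b} b∈ = ∃[ u ] ((B Sub.- b) *) u ×
        to (from i ⊙ (ρ (≈class (suc (proj₁ (classes b∈))) u) ⊙ ρʷ [ b ])) ⇝ʳ⟨ B ⟩ i
      Returnsˡ {b} b∈ = ∃[ u ] ((B Sub.- b) *) u ×
        to (ρʷ [ b ] ⊙ ρ (≈class (suc (proj₁ (classes b∈))) u) ⊙ from j) ⇝ˡ⟨ B ⟩ j

      alph-letter⊆ : ∀ {b} → b Sub.∈ B → alph [ b ] Sub.⊆ B
      alph-letter⊆ b∈ = alph-least [ _ ] (b∈ ∷ [])

      -⊆ : ∀ {b} → B Sub.- b Sub.⊆ B
      -⊆ {b} = Sub.p─q⊆p B Sub.⁅ b ⁆

      cut-first : ∀ {b} (b∈ : b Sub.∈ B) → ¬ Returnsʳ b∈ → ∃[ k ] Covered B (from i) (from j) k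
      cut-first {b} b∈ ¬ret = 3 ℕ.+ k₃ , covered
        where
        k₀ k₁ k₂ k₃ : ℕ
        k₀ = proj₁ (smaller b∈ i∈ j∈)
        k₁ = suc (proj₁ (classes b∈))
        -- The new context `i′` will depend on the prefix of `w`, but the number of rounds must not:
        -- the maximum is taken over the finitely many codes.
        below : ∃[ k ] ∀ {i′} → i′ ⊏ʳ⟨ B ⟩ i → from i′ ∈ S → Covered B (from i′) (from j) k
        below = uniformly Covered-mono lowerʳ
        k₂ = proj₁ below
        k₃ = k₀ ℕ.⊔ (k₁ ℕ.⊔ k₂)
        k₁≤ : k₁ ℕ.≤ k₃
        k₁≤ = ≤-trans (m≤m⊔n k₁ k₂) (m≤n⊔m k₀ _)
        k₂≤ : k₂ ℕ.≤ k₃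
        k₂≤ = ≤-trans (m≤n⊔m k₁ k₂) (m≤n⊔m k₀ _)
        k₀≤ : k₀ ℕ.≤ 3 ℕ.+ k₃
        k₀≤ = ≤-trans (m≤m⊔n k₀ _) (ℕ.m≤n+m k₃ 3)
        covered : Covered B (from i) (from j) (3 ℕ.+ k₃)
        covered w w∈ with first-occurrence b w
        ... | inj₁ w∌ = Covered-mono k₀≤ (proj₂ (smaller b∈ i∈ j∈)) w (∌⇒* w∈ w∌)
        ... | inj₂ (u , v , refl , u∌) =
          downward (proj₂ below (reach , stuck) i′∈ v (All.tail (All.++⁻ʳ u w∈))) shrink
          where
          u∈ : ((B Sub.- b) *) u
          u∈ = ∌⇒* (All.++⁻ˡ u w∈) u∌
          U = ρ (≈class k₁ u)
          U∈ : U ∈ S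
          U∈ = proj₂ (classes b∈) u u∈
          i′ = to (from i ⊙ (U ⊙ ρʷ [ b ]))
          i′∈ : from i′ ∈ S
          i′∈ = S-resp-≈ (R.sym (from-to _)) (multiply i∈ (multiply U∈ (ρʷ∈S [ b ])))
          reach : i ⇝ʳ⟨ B ⟩ i′
          reach = _ , _ , ∪-⊆ (alph-least u (All.map -⊆ u∈)) (alph-letter⊆ b∈) ,
            class _ u U∈ ∙ single [ b ] ,
            to-cong (R.*-congˡ (R.trans (from-to _) (R.*-cong (from-to _) (from-to _))))
          stuck : ¬ i′ ⇝ʳ⟨ B ⟩ i
          stuck h = ¬ret (u , u∈ , h)
          shrink : from i ⊙ ρ (≈class (3 ℕ.+ k₃) (u ++ b ∷ v)) ⊙ from j ⊑ from i′ ⊙ ρ (≈class k₂ v) ⊙ from j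
          shrink = ⊙-mono (⊑-trans (⊙-mono (≈⇒⊑ R.refl) (ρ-mono (≈class⊆-first k₁≤ k₂≤ u∌))) (≈⇒⊑ (begin
            from i ⊙ ρ ((≈class k₁ u · ｛ [ b ] ｝) · ≈class k₂ v)
              ≈⟨ R.*-congˡ (R.trans (ρ.*-homo _ _) (R.*-congʳ (ρ.*-homo _ _))) ⟩
            from i ⊙ (U ⊙ ρʷ [ b ] ⊙ ρ (≈class k₂ v))                     ≈⟨ R.*-assoc _ _ _ ⟨
            from i ⊙ (U ⊙ ρʷ [ b ]) ⊙ ρ (≈class k₂ v)                     ≈⟨ R.*-congʳ (from-to _) ⟨
            from i′ ⊙ ρ (≈class k₂ v)                                     ∎))) (≈⇒⊑ R.refl)

      cut-last : ∀ {b} (b∈ : b Sub.∈ B) → ¬ Returnsˡ b∈ → ∃[ k ] Covered B (from i) (from j) k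
      cut-last {b} b∈ ¬ret = 3 ℕ.+ k₃ , covered
        where
        k₀ k₁ k₂ k₃ : ℕ
        k₀ = proj₁ (smaller b∈ i∈ j∈)
        k₁ = suc (proj₁ (classes b∈))
        below : ∃[ k ] ∀ {j′} → j′ ⊏ˡ⟨ B ⟩ j → from j′ ∈ S → Covered B (from i) (from j′) k
        below = uniformly Covered-mono lowerˡ
        k₂ = proj₁ below
        k₃ = k₀ ℕ.⊔ (k₁ ℕ.⊔ k₂)
        k₁≤ : k₁ ℕ.≤ k₃
        k₁≤ = ≤-trans (m≤m⊔n k₁ k₂) (m≤n⊔m k₀ _)
        k₂≤ : k₂ ℕ.≤ k₃
        k₂≤ = ≤-trans (m≤n⊔m k₁ k₂) (m≤n⊔m k₀ _)
        k₀≤ : k₀ ℕ.≤ 3 ℕ.+ k₃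
        k₀≤ = ≤-trans (m≤m⊔n k₀ _) (ℕ.m≤n+m k₃ 3)
        covered : Covered B (from i) (from j) (3 ℕ.+ k₃)
        covered w w∈ with last-occurrence b w
        ... | inj₁ w∌ = Covered-mono k₀≤ (proj₂ (smaller b∈ i∈ j∈)) w (∌⇒* w∈ w∌)
        ... | inj₂ (u , v , refl , v∌) =
          downward (proj₂ below (reach , stuck) j′∈ u (All.++⁻ˡ u w∈)) shrink
          where
          v∈ : ((B Sub.- b) *) v
          v∈ = ∌⇒* (All.tail (All.++⁻ʳ u w∈)) v∌
          V = ρ (≈class k₁ v)
          V∈ : V ∈ S
          V∈ = proj₂ (classes b∈) v v∈
          j′ = to (ρʷ [ b ] ⊙ V ⊙ from j)
          j′∈ : from j′ ∈ S
          j′∈ = S-resp-≈ (R.sym (from-to _)) (multiply (multiply (ρʷ∈S [ b ]) V∈) j∈)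
          reach : j ⇝ˡ⟨ B ⟩ j′
          reach = _ , _ , ∪-⊆ (alph-letter⊆ b∈) (alph-least v (All.map -⊆ v∈)) ,
            single [ b ] ∙ class _ v V∈ ,
            to-cong (R.*-congʳ (R.trans (from-to _) (R.*-cong (from-to _) (from-to _))))
          stuck : ¬ j′ ⇝ˡ⟨ B ⟩ j
          stuck h = ¬ret (v , v∈ , h)
          shrink : from i ⊙ ρ (≈class (3 ℕ.+ k₃) (u ++ b ∷ v)) ⊙ from j ⊑ from i ⊙ ρ (≈class k₂ u) ⊙ from j′
          shrink = ⊑-trans (⊙-mono (⊙-mono (≈⇒⊑ R.refl) (ρ-mono (≈class⊆-last k₁≤ k₂≤ v∌))) (≈⇒⊑ R.refl)) (≈⇒⊑ (begin
            from i ⊙ ρ (≈class k₂ u · (｛ [ b ] ｝ · ≈class k₁ v)) ⊙ from j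
              ≈⟨ R.*-congʳ (R.*-congˡ (R.trans (ρ.*-homo _ _) (R.*-congˡ (ρ.*-homo _ _)))) ⟩
            from i ⊙ (ρ (≈class k₂ u) ⊙ (ρʷ [ b ] ⊙ V)) ⊙ from j ≈⟨ R.*-congʳ (R.*-assoc _ _ _) ⟨
            from i ⊙ ρ (≈class k₂ u) ⊙ (ρʷ [ b ] ⊙ V) ⊙ from j   ≈⟨ R.*-assoc _ _ _ ⟩
            from i ⊙ ρ (≈class k₂ u) ⊙ (ρʷ [ b ] ⊙ V ⊙ from j)   ≈⟨ R.*-congˡ (from-to _) ⟨
            from i ⊙ ρ (≈class k₂ u) ⊙ from j′                   ∎))

      no-cut : (∀ {b} (b∈ : b Sub.∈ B) → Returnsʳ b∈) → (∀ {b} (b∈ : b Sub.∈ B) → Returnsˡ b∈) →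
               ∃[ k ] Covered B (from i) (from j) k
      no-cut retʳ retˡ = finish
        (pure-idempotent (λ q → from i ⊙ from q ≈ from i)
          (R.trans (R.*-congˡ from-one) (R.*-identityʳ _))
          (λ x y → R.trans (R.*-congˡ (from-to _)) (R.trans (R.sym (R.*-assoc _ _ _)) (R.trans (R.*-congʳ x) y)))
          stabilisersʳ)
        (pure-idempotent (λ q → from q ⊙ from j ≈ from j)
          (R.trans (R.*-congʳ from-one) (R.*-identityˡ _))
          (λ x y → R.trans (R.*-congʳ (from-to _)) (R.trans (R.*-assoc _ _ _) (R.trans (R.*-congˡ y) x)))
          stabilisersˡ)
        where
        stabilisersʳ : ∀ {b} → b Sub.∈ B →
                       ∃₂ λ C q → b Sub.∈ C × C Sub.⊆ B × Pure C q × from i ⊙ from q ≈ from i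
        stabilisersʳ {b} b∈ with retʳ b∈
        ... | u , u∈ , C , q , C⊆ , p , eq =
          _ , _ , Sub.p⊆p∪q C (Sub.q⊆p∪q (alph u) (alph [ b ]) (Sub.p⊆p∪q _ (Sub.x∈⁅x⁆ b))) ,
          ∪-⊆ (∪-⊆ (alph-least u (All.map -⊆ u∈)) (alph-letter⊆ b∈)) C⊆ ,
          (class _ u (proj₂ (classes b∈) u u∈) ∙ single [ b ]) ∙ p ,
          (begin
            from i ⊙ from (to (from (to (from (to U) ⊙ from (to (ρʷ [ b ])))) ⊙ from q))
              ≈⟨ R.*-congˡ (R.trans (from-to _) (R.*-congʳ (R.trans (from-to _) (R.*-cong (from-to _) (from-to _))))) ⟩
            from i ⊙ (U ⊙ ρʷ [ b ] ⊙ from q)             ≈⟨ R.*-assoc _ _ _ ⟨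
            from i ⊙ (U ⊙ ρʷ [ b ]) ⊙ from q             ≈⟨ R.*-congʳ (from-to _) ⟨
            from (to (from i ⊙ (U ⊙ ρʷ [ b ]))) ⊙ from q ≈⟨ to⁻ eq ⟩
            from i                                       ∎)
          where U = ρ (≈class (suc (proj₁ (classes b∈))) u)
        stabilisersˡ : ∀ {b} → b Sub.∈ B →
                       ∃₂ λ C q → b Sub.∈ C × C Sub.⊆ B × Pure C q × from q ⊙ from j ≈ from j
        stabilisersˡ {b} b∈ with retˡ b∈
        ... | v , v∈ , C , q , C⊆ , p , eq =
          _ , _ , Sub.q⊆p∪q C _ (Sub.p⊆p∪q (alph v) (Sub.p⊆p∪q _ (Sub.x∈⁅x⁆ b))) ,
          ∪-⊆ C⊆ (∪-⊆ (alph-letter⊆ b∈) (alph-least v (All.map -⊆ v∈))) ,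
          p ∙ (single [ b ] ∙ class _ v (proj₂ (classes b∈) v v∈)) ,
          (begin
            from (to (from q ⊙ from (to (from (to (ρʷ [ b ])) ⊙ from (to V))))) ⊙ from j
              ≈⟨ R.*-congʳ (R.trans (from-to _) (R.*-congˡ (R.trans (from-to _) (R.*-cong (from-to _) (from-to _))))) ⟩
            from q ⊙ (ρʷ [ b ] ⊙ V) ⊙ from j           ≈⟨ R.*-assoc _ _ _ ⟩
            from q ⊙ (ρʷ [ b ] ⊙ V ⊙ from j)           ≈⟨ R.*-congˡ (from-to _) ⟨
            from q ⊙ from (to (ρʷ [ b ] ⊙ V ⊙ from j)) ≈⟨ to⁻ eq ⟩
            from j                                     ∎)
          where V = ρ (≈class (suc (proj₁ (classes b∈))) v)
        finish : ∃[ e ] Pure B e × from i ⊙ from e ≈ from i × from e ⊙ from e ≈ from e →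
                 ∃[ f ] Pure B f × from f ⊙ from j ≈ from j × from f ⊙ from f ≈ from f →
                 ∃[ k ] Covered B (from i) (from j) k
        -- One round is enough here: it keeps the class of a word of `B *` inside `B *`.
        finish (e , pᵉ , ie , idemᵉ) (f , pᶠ , fj , idemᶠ) = 1 , λ w w∈ → downward
          (multiply (multiply i∈ (operation B (Pure⇒∈ pᵉ) (Pure⇒∈ pᶠ) idemᵉ idemᶠ (Pure⇒alph pᵉ) (Pure⇒alph pᶠ))) j∈)
          (⊑-trans (⊙-mono (⊙-mono (≈⇒⊑ R.refl) (ρ-mono λ e → ≈⇒All e w∈)) (≈⇒⊑ R.refl)) (≈⇒⊑ (begin
            from i ⊙ ρ (B *) ⊙ from j                          ≈⟨ R.*-cong (R.*-congʳ ie) fj ⟨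
            from i ⊙ from e ⊙ ρ (B *) ⊙ (from f ⊙ from j)      ≈⟨ R.*-assoc _ _ _ ⟨
            from i ⊙ from e ⊙ ρ (B *) ⊙ from f ⊙ from j        ≈⟨ R.*-congʳ (R.*-congʳ (R.*-assoc _ _ _)) ⟩
            from i ⊙ (from e ⊙ ρ (B *)) ⊙ from f ⊙ from j      ≈⟨ R.*-congʳ (R.*-assoc _ _ _) ⟩
            from i ⊙ (from e ⊙ ρ (B *) ⊙ from f) ⊙ from j      ∎)))

      conclusion : ∃[ k ] Covered B (from i) (from j) k
      conclusion
        with excluded-middle (∃[ b ] Σ[ b∈ ∈ b Sub.∈ B ] ¬ Returnsʳ b∈)
           | excluded-middle (∃[ b ] Σ[ b∈ ∈ b Sub.∈ B ] ¬ Returnsˡ b∈)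
      ... | yes (_ , b∈ , ¬ret) | _                   = cut-first b∈ ¬ret
      ... | no _                | yes (_ , b∈ , ¬ret) = cut-last b∈ ¬ret
      ... | no ¬∃ʳ              | no ¬∃ˡ              =
        no-cut (λ b∈ → decidable-stable (excluded-middle _) λ ¬ret → ¬∃ʳ (_ , b∈ , ¬ret))
               (λ b∈ → decidable-stable (excluded-middle _) λ ¬ret → ¬∃ˡ (_ , b∈ , ¬ret))

    -- A smaller alphabet restarts both contexts with fresh accessibility proofs, since its strict
    -- orders are different ones. Empty B needs no base case: there is no letter to cut at, and the
    -- stabilising idempotents are then powers of `one`.
    covered : ∀ B → Acc ℕ._<_ Sub.∣ B ∣ → ∀ i → Acc (_⊏ʳ⟨ B ⟩_) i → ∀ j → Acc (_⊏ˡ⟨ B ⟩_) j →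
              from i ∈ S → from j ∈ S → ∃[ k ] Covered B (from i) (from j) k
    ⊏ʳ-wellFounded : ∀ B → WellFounded (_⊏ʳ⟨ B ⟩_)
    ⊏ʳ-wellFounded B = strict-wellFounded ⇝ʳ-refl ⇝ʳ-trans
    ⊏ˡ-wellFounded : ∀ B → WellFounded (_⊏ˡ⟨ B ⟩_)
    ⊏ˡ-wellFounded B = strict-wellFounded ⇝ˡ-refl ⇝ˡ-trans
    covered B (acc recᴮ) i (acc recʳ) j (acc recˡ) i∈ j∈ = Step.conclusion B i j i∈ j∈
      (λ b∈ {i′} {j′} → covered (B Sub.- _) (recᴮ (Sub.x∈p⇒∣p-x∣<∣p∣ b∈))
        i′ (⊏ʳ-wellFounded _ i′) j′ (⊏ˡ-wellFounded _ j′))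
      (λ {i′} lt i′∈ → covered B (acc recᴮ) i′ (recʳ lt) j (acc recˡ) i′∈ j∈)
      (λ {j′} lt j′∈ → covered B (acc recᴮ) i (acc recʳ) j′ (recˡ lt) i∈ j′∈)

    classes∈ : ∃[ k ] ∀ w → ρ (≈class k w) ∈ S
    classes∈ =
      let one∈ = S-resp-≈ (R.sym from-one) 1∈S
          k , h = covered Sub.⊤ (<-wellFounded _) one (⊏ʳ-wellFounded _ one) one (⊏ˡ-wellFounded _ one) one∈ one∈
      in k , λ w → S-resp-≈
           (R.trans (R.*-cong (R.trans (R.*-congʳ from-one) (R.*-identityˡ _)) from-one) (R.*-identityʳ _))
           (h w (All.universal (λ _ → Sub.∈⊤) w))

  -- Covers by Hintikka sentences and the optimal imprint

  open Hintikka excluded-middle {n}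

  classCover : ℕ → List (Language n)
  classCover k = map (λ φ → _⊨ φ) (sentences k)

  classCover-isCover : ∀ k → UniversalCover FO² (classCover k)
  classCover-isCover k = record
    { inClass = All.map⁺ (All.map (λ {φ} closed → φ , closed , (λ {_} h → h) , λ {_} h → h) (sentences-closed k))
    ; covers  = λ w → Any.map⁺ (sentences-cover k w)
    }

  classCover-imprint : ∀ {S : Pred Carrier 0ℓ} → Saturated S → ∀ k → (∀ w → ρ (≈class k w) ∈ S) →
                       imprint ratingMap (classCover k) ⊆ S
  classCover-imprint sat k h r∈ with List.find (Any.map⁻ r∈)
  ... | φ , φ∈ , r⊑ with excluded-middle (∃[ w ] w ⊨ φ)
  ...   | yes (w , w⊨φ) = S.downward (h w) (⊑-trans r⊑ (ρ-mono (sentences⇒≈ k φ∈ w⊨φ)))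
    where module S = FO²-Saturated sat
  -- A contradictory cell defines the empty language, whose value lies below that of any word; the
  -- empty word is an arbitrary choice.
  ...   | no ¬∃ = S.trivial ([] , ⊑-trans r⊑ (ρ-mono λ {w} w⊨φ → ⊥-elim (¬∃ (w , w⊨φ))))
    where module S = FO²-Saturated sat

  ClosedUnder : ℕ → Language n → Set
  ClosedUnder k K = ∀ w v → w ≈[ k ] v → w ∈ K → v ∈ K

  FO²-ClosedUnder : ∀ 𝐊 → All FO² 𝐊 → ∃[ k ] All (ClosedUnder k) 𝐊
  FO²-ClosedUnder []      []                              = 0 , []
  FO²-ClosedUnder (K ∷ 𝐊) ((φ , _ , K⊆ , ⊆K) ∷ hs) with FO²-ClosedUnder 𝐊 hs
  ... | k , closed = rank φ ℕ.⊔ k ,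
    (λ _ _ e w∈ → ⊆K (≈⇒⊨ φ (≈-mono (m≤m⊔n _ k) e) (K⊆ w∈))) ∷
    All.map (λ c w v e → c w v (≈-mono (m≤n⊔m (rank φ) k) e)) closed

  -- For `k` above all ranks in the cover, the member that contains `w` contains its whole class. An
  -- element below the value of a class is thus below the value of a member.
  least⊆imprint : ∀ 𝐊 → UniversalCover FO² 𝐊 → least ⊆ imprint ratingMap 𝐊
  least⊆imprint 𝐊 cover l with FO²-ClosedUnder 𝐊 (UniversalCover.inClass cover)
  ... | k , closed with least⊆ (classImprint-saturated k) l
  ...   | w , r⊑ = go closed (UniversalCover.covers cover w)
    where
    go : ∀ {𝐊} → All (ClosedUnder k) 𝐊 → Any (w ∈_) 𝐊 → Any (λ K → _ ⊑ ρ K) 𝐊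
    go (c ∷ _)  (here w∈)  = here (⊑-trans r⊑ (ρ-mono λ e → c _ _ e w∈))
    go (_ ∷ cs) (there w∈) = there (go cs w∈)

  optimalImprint≐least : optimalImprint ratingMap FO² ≐ least
  optimalImprint≐least =
    (λ (𝐊 , o , r∈) → ⊆least (OptimalCover.optimal o (classCover k₀) (classCover-isCover k₀) r∈)) ,
    λ l → classCover k₀ , record
      { isCover = classCover-isCover k₀
      ; optimal = λ 𝐊 cover r∈ → least⊆imprint 𝐊 cover (⊆least r∈)
      } , least⊆imprint (classCover k₀) (classCover-isCover k₀) l
    where
    k₀ = proj₁ (Completeness.classes∈ least-saturated)
    ⊆least : imprint ratingMap (classCover k₀) ⊆ least
    ⊆least = classCover-imprint least-saturated k₀ (proj₂ (Completeness.classes∈ least-saturated))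

  saturated-resp-≐ : ∀ {s t} {S : Pred Carrier s} {T : Pred Carrier t} → S ≐ T → Saturated S → Saturated T
  saturated-resp-≐ (S⊆T , T⊆S) sat = record
    { trivial   = λ h → S⊆T (S.trivial h)
    ; downward  = λ t h → S⊆T (S.downward (T⊆S t) h)
    ; multiply  = λ t u → S⊆T (S.multiply (T⊆S t) (T⊆S u))
    ; operation = λ B e f ee ff αe αf → S⊆T (S.operation B (T⊆S e) (T⊆S f) ee ff αe αf)
    }
    where module S = FO²-Saturated sat

theorem8p6 : ∀ {c ℓ s : Level} (n : ℕ) (R : IdempotentSemiring c ℓ) → FiniteSemiring R →
    (ratingMap : RatingMap R n) (compat : AlphabetCompatible ratingMap) →
    FO²-Saturated compat (optimalImprint ratingMap FO²) ×
    (∀ (S : Pred (IdempotentSemiring.Carrier R) s) →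
    FO²-Saturated compat S → optimalImprint ratingMap FO² ⊆ S)
theorem8p6 n R finite ratingMap compat =
  saturated-resp-≐ (swap optimalImprint≐least) least-saturated ,
  λ S sat → least⊆ sat ∘ proj₁ optimalImprint≐least
  where open Proof R finite ratingMap compat
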